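{- Let $C_0>0$. There is a constant $C>0$ depending only on $C_0$ such that for every triangular color-code lattice with $n$ vertices equipped with a wall system of spacing $\tau$ with constant $C_0$, and every valid syndrome $S$, the block decoder outputs a correction $E_{\mathrm{alg}}\subseteq F$ satisfying $$S(E_{\mathrm{alg}})=S\qquad\text{and}\qquad |E_{\mathrm{alg}}|\le \mathrm{OPT}(S)+C\,\frac{n}{\tau}.$$
   Context: A triangular color-code lattice is a finite two-dimensional triangulated cell complex with vertex set $V$, $n=|V|$, and set $F$ of triangular faces; its vertices are colored with three colors $R,G,B$ so that each face has exactly one vertex of each color; $V_c$ is the set of vertices of color $c$. Write $v\in f$ if $v$ is a vertex of $f$; then $v$ and $f$ are incident. For $E\subseteq F$ the syndrome is $S(E)=\{v\in V: |\{f\in E: v\in f\}|\equiv 1 \pmod 2\}$. A set $S\subseteq V$ is a valid syndrome if $S=S(E)$ for some $E\subseteq F$; then $\mathrm{OPT}(S)=\min\{|E|:E\subseteq F,\ S(E)=S\}$. $\oplus$ is symmetric difference. Block decomposition. Given a set $F_\partial\subseteq F$ of boundary faces (formed by vertical and anti-diagonal columns of triangles, "walls", periodically spaced at distance $\tau$), put $V_\partial=\{v:\exists f\in F_\partial,\ v\in f\}$, $V_{\mathrm{int}}=V\setminus V_\partial$, $F_{\mathrm{int}}=F\setminus F_\partial$. The blocks $B_1,\dots,B_q$ are the connected components of $F_{\mathrm{int}}$, two faces being adjacent if they share a vertex. $F(B_i)$ is the set of faces of $B_i$, $V(B_i)$ the set of vertices incident to them, and $I(B_i)=V(B_i)\cap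 V_{\mathrm{int}}$. For each color $c$, the boundary graph $H_c$ has vertex set $V_\partial\cap V_c$, with $u,v$ adjacent if there are two adjacent boundary faces $f^1,f^2\in F_\partial$ with $S(\{f^1,f^2\})=\{u,v\}$ (one such two-face move is fixed for each edge); $A(H_c)$ is its edge set. Such a set $F_\partial$ is a wall system of spacing $\tau$ ($1\le\tau\le n$) with constant $C_0$ if: (i) each $H_c$ is connected; (ii) there is a boundary face $f^\star\in F_\partial$ whose three vertices belong to $H_R,H_G,H_B$ respectively; (iii) $|A(H_R)|+|A(H_G)|+|A(H_B)|\le C_0 n/\tau$. Block decoder (input: valid syndrome $S$, wall system given). If $S=\emptyset$, return $\emptyset$. Otherwise, for each block compute a minimum-size $E_i\subseteq F(B_i)$ with $S(E_i)\cap I(B_i)=S\cap I(B_i)$ (no constraint on $V_\partial$). Let $E_{\mathrm{loc}}=\bigoplus_i E_i$ and $R=S\oplus S(E_{\mathrm{loc}})\subseteq V_\partial$. Then compute $E_\partial\subseteq F_\partial$ with $S(E_\partial)=R$: for each color $c$ take a spanning tree of $H_c$; if all $|R\cap V_c|$ are even, choose in each tree the edge set whose odd-degree vertices are exactly $R\cap V_c$ and take the symmetric difference of the corresponding two-face moves; if all are odd, choose $x_c\in R\cap V_c$ for each $c$, do this for $(R\cap V_c)\setminus\{x_c\}$ and additionally for $\{x_c,x_c^\star\}$, where $x_c^\star$ is the color-$c$ vertex of $f^\star$, and add $f^\star$. Output $E_{\mathrm{alg}}=E_{\mathrm{loc}}\oplus E_\partial$. -}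

module Defs where

open import Data.Bool.Base using (_xor_; if_then_else_)
import Data.Bool.Properties as Bool
open import Data.Fin.Base using (Fin; zero; suc) renaming (_<_ to _<ᶠ_)
open import Data.Fin.Properties using (any?) renaming (_<?_ to _<ᶠ?_)
open import Data.Fin.Subset
open import Data.Fin.Subset.Properties using (_∈?_; anySubset?)
open import Data.Integer.Base using (+_)
open import Data.List.Base as List using (List; length; filter; cartesianProduct; allFin; _∷ʳ_)
open import Data.List.Relation.Unary.Linked using (Linked)
open import Data.List.Relation.Unary.Unique.Propositional using (Unique)
open import Data.Nat.Base as ℕ using (ℕ; NonZero; _%_)
open import Data.Nat.Induction using (Acc; acc; <-wellFounded)
import Data.Nat.Properties as ℕ
open import Data.Product using (∃; ∃!; _×_; _,_; proj₁; proj₂)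
open import Data.Rational.Unnormalised.Base as ℚ using (ℚᵘ)
open import Data.Sum.Base using (_⊎_)
open import Data.Vec.Base using ([]; _∷_; tabulate; zipWith)
open import Data.Vec.Properties using (≡-dec)
open import Function.Base using (_∘_)
open import Function.Bundles using (_⇔_)
open import Function.Definitions using (Injective)
open import Level using (0ℓ)
open import Relation.Binary.Construct.Closure.ReflexiveTransitive using (Star)
open import Relation.Binary.Core using (Rel)
open import Relation.Binary.Definitions using (DecidableEquality)
open import Relation.Binary.PropositionalEquality.Core using (_≡_; refl)
open import Relation.Nullary using (¬_; Dec; yes; no; does)
open import Relation.Nullary.Decidable using (_×-dec_)
open import Relation.Unary using (Pred; Decidable)

private
  variable
    k m n : ℕ

Even Odd : ℕ → Set
Even i = i % 2 ≡ 0
Odd  i = i % 2 ≡ 1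

_≟ˢ_ : DecidableEquality (Subset n)
_≟ˢ_ = ≡-dec Bool._≟_

infixl 5 _⊕_

_⊕_ : Subset n → Subset n → Subset n
_⊕_ = zipWith _xor_

-- ⨁ J g is the iterated symmetric difference of the sets g j, j ∈ J.

⨁ : Subset k → (Fin k → Subset n) → Subset n
⨁ []      g = ⊥
⨁ (b ∷ J) g = (if b then g zero else ⊥) ⊕ ⨁ J (g ∘ suc)

subset : {P : Pred (Fin n) 0ℓ} → Decidable P → Subset n
subset P? = tabulate (does ∘ P?)

-- Given sets X i ⊆ {0,…,n-1}, one for each i < k: the elements lying in
-- an odd number of the X i with i ∈ J.

oddlyCovered : (Fin k → Subset n) → Subset k → Subset n
oddlyCovered X J =
  subset λ v → ∣ J ∩ subset (λ i → v ∈? X i) ∣ % 2 ℕ.≟ 1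

IsMinimum : Pred (Subset n) 0ℓ → Pred (Subset n) 0ℓ
IsMinimum P E = P E × (∀ E′ → P E′ → ∣ E ∣ ℕ.≤ ∣ E′ ∣)

minimum : {P : Pred (Subset n) 0ℓ} → Decidable P → ∃ P → ∃ (IsMinimum P)
minimum {n} {P} P? (E , p) = go E p (<-wellFounded ∣ E ∣)
  where
  go : ∀ E → P E → Acc ℕ._<_ ∣ E ∣ → ∃ (IsMinimum P)
  go E p (acc rec) with anySubset? (λ E′ → P? E′ ×-dec (∣ E′ ∣ ℕ.<? ∣ E ∣))
  ... | yes (E′ , p′ , lt) = go E′ p′ (rec lt)
  ... | no ∄smaller        =
    E , p , λ E′ p′ → ℕ.≮⇒≥ (λ lt → ∄smaller (E′ , p′ , lt))

Path : Subset n → Rel (Fin n) 0ℓ → Rel (Fin n) 0ℓ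
Path X _~_ = Star (λ a b → a ∈ X × b ∈ X × a ~ b)

Connected : Subset n → Rel (Fin n) 0ℓ → Set
Connected X _~_ = ∀ {a b} → a ∈ X → b ∈ X → Path X _~_ a b

IsComponent : Subset n → Rel (Fin n) 0ℓ → Subset n → Set
IsComponent X _~_ Y = ∃ λ a → a ∈ X × (∀ b → b ∈ Y ⇔ Path X _~_ a b)

-- No cycle v, v₁, …, vₗ, v through at least three distinct vertices.

Acyclic : Rel (Fin n) 0ℓ → Set
Acyclic _~_ = ∀ {v vs} → Unique (v List.∷ vs) → 2 ℕ.≤ length vs →
              ¬ Linked _~_ (v List.∷ (vs ∷ʳ v))

-- Cells are given with their sets of boundary cells.  Distinct cells may
-- have the same vertex set.

record TriangulatedComplex : Set where
  field
    #V #E #F : ℕ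
    ends     : Fin #E → Subset #V
    corners  : Fin #F → Subset #V
    sides    : Fin #F → Subset #E
    ∣ends∣    : ∀ e → ∣ ends e ∣ ≡ 2
    ∣corners∣ : ∀ f → ∣ corners f ∣ ≡ 3
    sides-⊆  : ∀ f {e} → e ∈ sides f → ends e ⊆ corners f
    side!    : ∀ f {P} → P ⊆ corners f → ∣ P ∣ ≡ 2 →
               ∃! _≡_ λ e → e ∈ sides f × ends e ≡ P

data Color : Set where
  red green blue : Color

_≟ᶜ_ : DecidableEquality Color
red   ≟ᶜ red   = yes refl
red   ≟ᶜ green = no λ ()
red   ≟ᶜ blue  = no λ ()
green ≟ᶜ red   = no λ ()
green ≟ᶜ green = yes refl
green ≟ᶜ blue  = no λ ()
blue  ≟ᶜ red   = no λ ()
blue  ≟ᶜ green = no λ ()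
blue  ≟ᶜ blue  = yes refl

record ColorCodeLattice : Set where
  field
    complex : TriangulatedComplex
  open TriangulatedComplex complex public
  field
    color      : Fin #V → Color
    tricolored : ∀ f c → ∃! _≡_ λ v → v ∈ corners f × color v ≡ c

  V[_] : Color → Subset #V
  V[ c ] = subset λ v → color v ≟ᶜ c

  corner : Fin #F → Color → Fin #V
  corner f c = proj₁ (tricolored f c)

  syndrome : Subset #F → Subset #V
  syndrome = oddlyCovered corners

  Valid : Subset #V → Set
  Valid S = ∃ λ E → syndrome E ≡ S

  OPT : ∀ {S} → Valid S → ℕ
  OPT {S} valid = ∣ proj₁ (minimum (λ E → syndrome E ≟ˢ S) valid) ∣

  vertices : Subset #F → Subset #V
  vertices X = subset λ v → any? λ f → (f ∈? X) ×-dec (v ∈? corners f)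

  Adjacent : Rel (Fin #F) 0ℓ
  Adjacent f g = ∃ λ v → v ∈ corners f × v ∈ corners g

  Adjacent? : ∀ f g → Dec (Adjacent f g)
  Adjacent? f g = any? λ v → (v ∈? corners f) ×-dec (v ∈? corners g)

module Boundary (L : ColorCodeLattice)
                (F∂ : Subset (ColorCodeLattice.#F L)) where
  open ColorCodeLattice L

  V∂ Vint : Subset #V
  V∂   = vertices F∂
  Vint = ∁ V∂

  Fint : Subset #F
  Fint = ∁ F∂

  IsBlock : Subset #F → Set
  IsBlock = IsComponent Fint Adjacent

  record Blocks : Set where
    field
      q          : ℕ
      block      : Fin q → Subset #F
      isBlock    : ∀ i → IsBlock (block i)
      distinct   : Injective _≡_ _≡_ block
      exhaustive : ∀ {X} → IsBlock X → ∃ λ i → block i ≡ X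

  interior : Subset #F → Subset #V
  interior B = vertices B ∩ Vint

  H[_] : Color → Subset #V
  H[ c ] = V∂ ∩ V[ c ]

  IsMove : Fin #V → Fin #V → Fin #F × Fin #F → Set
  IsMove u v (f , g) = f ∈ F∂ × g ∈ F∂ × Adjacent f g ×
                       syndrome (⁅ f ⁆ ∪ ⁅ g ⁆) ≡ ⁅ u ⁆ ∪ ⁅ v ⁆

  HAdjacent : Color → Rel (Fin #V) 0ℓ
  HAdjacent c u v = u ∈ H[ c ] × v ∈ H[ c ] × ∃ λ f → ∃ λ g → IsMove u v (f , g)

  HAdjacent? : ∀ c u v → Dec (HAdjacent c u v)
  HAdjacent? c u v =
    (u ∈? H[ c ]) ×-dec (v ∈? H[ c ]) ×-dec any? λ f → any? λ g →
      (f ∈? F∂) ×-dec (g ∈? F∂) ×-dec Adjacent? f g ×-dec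
      (syndrome (⁅ f ⁆ ∪ ⁅ g ⁆) ≟ˢ (⁅ u ⁆ ∪ ⁅ v ⁆))

  -- The edge {u , v} is listed once, as the pair with u < v.

  A : Color → List (Fin #V × Fin #V)
  A c = filter (λ (u , v) → (u <ᶠ? v) ×-dec HAdjacent? c u v)
               (cartesianProduct (allFin #V) (allFin #V))

  #A : Color → ℕ
  #A c = length (A c)

  -- Edges of the boundary graph of color c are positions in A c.

  src tgt : ∀ c → Fin (#A c) → Fin #V
  src c e = proj₁ (List.lookup (A c) e)
  tgt c e = proj₂ (List.lookup (A c) e)

  JoinedBy : ∀ c → Subset (#A c) → Rel (Fin #V) 0ℓ
  JoinedBy c T u v = ∃ λ e → e ∈ T ×
    ((src c e ≡ u × tgt c e ≡ v) ⊎ (src c e ≡ v × tgt c e ≡ u))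

  IsSpanningTree : ∀ c → Subset (#A c) → Set
  IsSpanningTree c T = Connected H[ c ] (JoinedBy c T) × Acyclic (JoinedBy c T)

  oddDegree : ∀ c → Subset (#A c) → Subset #V
  oddDegree c = oddlyCovered λ e → ⁅ src c e ⁆ ∪ ⁅ tgt c e ⁆

  IsJoin : ∀ c → Subset (#A c) → Subset #V → Subset (#A c) → Set
  IsJoin c T X J = J ⊆ T × oddDegree c J ≡ X

ratio : ℕ → (d : ℕ) .{{_ : NonZero d}} → ℚᵘ
ratio i d = + i ℚ./ d

fromℕ : ℕ → ℚᵘ
fromℕ i = ratio i 1

record WallSystem (L : ColorCodeLattice) (τ : ℕ) .{{_ : NonZero τ}} (C₀ : ℚᵘ) : Set where
  open ColorCodeLattice L
  field
    F∂ : Subset #F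
  open Boundary L F∂ public
  field
    τ≤n       : τ ℕ.≤ #V
    connected : ∀ c → Connected H[ c ] (HAdjacent c)
    f★        : Fin #F
    f★∈F∂     : f★ ∈ F∂
    f★-corner : ∀ c → corner f★ c ∈ H[ c ]
    few-edges : fromℕ (#A red ℕ.+ #A green ℕ.+ #A blue) ℚ.≤ C₀ ℚ.* ratio #V τ
    move      : ∀ c → Fin (#A c) → Fin #F × Fin #F
    isMove    : ∀ c e → IsMove (src c e) (tgt c e) (move c e)

module Decoder (L : ColorCodeLattice) {τ : ℕ} .{{_ : NonZero τ}} {C₀ : ℚᵘ}
               (W : WallSystem L τ C₀) where
  open ColorCodeLattice L
  open WallSystem W

  moves : (∀ c → Subset (#A c)) → Subset #F
  moves J = along red ⊕ along green ⊕ along blue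
    where
    along : Color → Subset #F
    along c = ⨁ (J c) λ e → ⁅ proj₁ (move c e) ⁆ ∪ ⁅ proj₂ (move c e) ⁆

  IsLocalCorrection : Subset #V → Subset #F → Subset #F → Set
  IsLocalCorrection S B E = E ⊆ B × syndrome E ∩ interior B ≡ S ∩ interior B

  -- In the odd case the pair {x c , corner f★ c} is taken mod 2, so that
  -- it is empty when the two vertices coincide; likewise f★ is added mod 2.

  data BoundaryCorrection (R : Subset #V) : Subset #F → Set where
    even : (∀ c → Even ∣ R ∩ V[ c ] ∣) →
           (T J : ∀ c → Subset (#A c)) →
           (∀ c → IsSpanningTree c (T c)) →
           (∀ c → IsJoin c (T c) (R ∩ V[ c ]) (J c)) →
           BoundaryCorrection R (moves J)
    odd  : (∀ c → Odd ∣ R ∩ V[ c ] ∣) →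
           (T J J★ : ∀ c → Subset (#A c)) →
           (∀ c → IsSpanningTree c (T c)) →
           (x : Color → Fin #V) →
           (∀ c → x c ∈ R ∩ V[ c ]) →
           (∀ c → IsJoin c (T c) ((R ∩ V[ c ]) - x c) (J c)) →
           (∀ c → IsJoin c (T c) (⁅ x c ⁆ ⊕ ⁅ corner f★ c ⁆) (J★ c)) →
           BoundaryCorrection R (moves J ⊕ moves J★ ⊕ ⁅ f★ ⁆)

  -- Every way of resolving the arbitrary choices of the decoder gives an
  -- output, so this is a relation.

  data Outputs (S : Subset #V) : Subset #F → Set where
    trivial : S ≡ ⊥ → Outputs S ⊥
    decode  : Nonempty S → (bs : Blocks) → let open Blocks bs in
              (E : Fin q → Subset #F) →
              (∀ i → IsMinimum (IsLocalCorrection S (block i)) (E i)) →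
              let Eloc = ⨁ ⊤ E in
              ∀ {E∂} → BoundaryCorrection (S ⊕ syndrome Eloc) E∂ →
              Outputs S (Eloc ⊕ E∂)

{-# OPTIONS --safe #-}

-- Over 𝔽₂ the syndrome is a linear map, and a face has one corner of each
-- color, so a syndrome meets all three color classes with the parity of the
-- number of faces.  All faces around an interior vertex lie in one block;
-- hence restricting an optimal correction to a block is feasible there, the
-- local corrections together cost at most OPT, and the residual syndrome is
-- supported on the walls.  The residual is matched along spanning trees (paths
-- to a root, summed over an even set of vertices; f★ repairs the odd case),
-- which uses each edge of the boundary graphs at most twice and each edge costs
-- two faces.  With the face f★ this gives C = 4 C₀ + 1, as 1 ≤ n/τ.

module Submission where

open import Defs
open import Data.Bool.Base using (Bool; true; false; not; _xor_; _∧_; if_then_else_)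
import Data.Bool.Properties as Bool
open import Data.Fin.Base using (Fin; zero; suc)
open import Data.Fin.Properties
  using (any?; all?; <-cmp; <-irrefl; suc-injective)
  renaming (_≟_ to _≟ᶠ_; _<?_ to _<ᶠ?_)
open import Data.Fin.Subset
open import Data.Fin.Subset.Properties
import Data.Integer.Base as ℤ
import Data.Integer.Properties as ℤ
open import Data.List.Base as List
  using (List; []; _∷_; _∷ʳ_; length; filter; deduplicate; allFin; cartesianProduct)
open import Data.List.Membership.Propositional using () renaming (_∈_ to _∈ˡ_)
open import Data.List.Membership.Propositional.Properties
  using (∈-lookup; ∈-allFin; ∈-filter⁺; ∈-filter⁻; ∈-map⁺; ∈-map⁻;
         ∈-deduplicate⁺; ∈-deduplicate⁻; ∈-cartesianProduct⁺)
open import Data.List.Relation.Unary.All as All using (All; []; _∷_)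
open import Data.List.Relation.Unary.AllPairs using ([]; _∷_)
open import Data.List.Relation.Unary.Any using (index)
open import Data.List.Relation.Unary.Any.Properties using (lookup-index)
open import Data.List.Relation.Unary.Linked using (Linked; []; [-]; _∷_)
open import Data.List.Relation.Unary.Unique.DecPropositional.Properties using (deduplicate-!)
open import Data.List.Relation.Unary.Unique.Propositional using (Unique)
open import Data.Nat.Base as ℕ using (ℕ; NonZero; _%_)
open import Data.Nat.Induction using (Acc; acc; <-wellFounded)
import Data.Nat.Properties as ℕ
open import Data.Product.Base using (∃; _×_; _,_; proj₁; proj₂)
open import Data.Rational.Unnormalised.Base as ℚ using (ℚᵘ; mkℚᵘ; Positive; _≤_; _+_; _*_)
import Data.Rational.Unnormalised.Properties as ℚ
open import Data.Sum.Base using (_⊎_; inj₁; inj₂; [_,_]; swap)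
open import Data.Vec.Base using ([]; _∷_; lookup; here; there)
open import Data.Vec.Properties
  using (lookup-zipWith; lookup-replicate; lookup∘tabulate; tabulate∘lookup; tabulate-cong;
         []=⇒lookup; lookup⇒[]=; zipWith-identityˡ; zipWith-identityʳ; zipWith-comm; zipWith-assoc)
open import Function.Base using (_∘_; id; const)
open import Function.Bundles using (_⇔_; mk⇔; Equivalence)
open import Level using (0ℓ)
open import Relation.Binary.Construct.Closure.ReflexiveTransitive
  using (Star; ε; _◅_; _◅◅_; reverse; kleisliStar)
open import Relation.Binary.Core using (Rel)
open import Relation.Binary.Definitions using (Decidable; Symmetric; tri<; tri≈; tri>)
open import Relation.Binary.PropositionalEquality
  using (_≡_; _≢_; refl; sym; trans; cong; cong₂; subst; subst₂; module ≡-Reasoning)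
open import Relation.Nullary using (Dec; yes; no; does; contradiction; ¬?)
open import Relation.Nullary.Decidable using (_×-dec_; _⊎-dec_; _→-dec_; map′; dec-true)

private
  variable
    k m n : ℕ

-- Subsets as vectors over 𝔽₂: symmetric difference and cardinality.

lookup-ext : {p q : Subset n} → (∀ i → lookup p i ≡ lookup q i) → p ≡ q
lookup-ext {p = p} {q} p≗q =
  trans (sym (tabulate∘lookup p)) (trans (tabulate-cong p≗q) (tabulate∘lookup q))

∉⇒lookup : ∀ {x} {p : Subset n} → x ∉ p → lookup p x ≡ false
∉⇒lookup {x = x} {p} x∉p = Bool.¬-not (x∉p ∘ lookup⇒[]= x p)

∈⇒lookup : ∀ {x} {p : Subset n} → x ∈ p → lookup p x ≡ true
∈⇒lookup = []=⇒lookup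

does-∈? : ∀ x (p : Subset n) → does (x ∈? p) ≡ lookup p x
does-∈? x p with x ∈? p
... | yes x∈p = sym (∈⇒lookup x∈p)
... | no  x∉p = sym (∉⇒lookup x∉p)

∈-subset⁺ : ∀ {P : Fin n → Set} (P? : ∀ x → Dec (P x)) {x} → P x → x ∈ subset P?
∈-subset⁺ P? {x} px = lookup⇒[]= x _ (trans (lookup∘tabulate _ x) (dec-true (P? x) px))

∈-subset⁻ : ∀ {P : Fin n → Set} (P? : ∀ x → Dec (P x)) {x} → x ∈ subset P? → P x
∈-subset⁻ P? {x} x∈ with P? x | trans (sym (lookup∘tabulate (does ∘ P?) x)) (∈⇒lookup x∈)
... | yes px | _ = px
... | no  _  | ()

lookup-⊕ : ∀ (p q : Subset n) x → lookup (p ⊕ q) x ≡ lookup p x xor lookup q x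
lookup-⊕ p q x = lookup-zipWith _xor_ x p q

⊕-identityˡ : (p : Subset n) → ⊥ ⊕ p ≡ p
⊕-identityˡ = zipWith-identityˡ Bool.xor-identityˡ

⊕-identityʳ : (p : Subset n) → p ⊕ ⊥ ≡ p
⊕-identityʳ = zipWith-identityʳ Bool.xor-identityʳ

⊕-comm : (p q : Subset n) → p ⊕ q ≡ q ⊕ p
⊕-comm = zipWith-comm Bool.xor-comm

⊕-assoc : (p q r : Subset n) → (p ⊕ q) ⊕ r ≡ p ⊕ (q ⊕ r)
⊕-assoc = zipWith-assoc Bool.xor-assoc

⊕-same : (p : Subset n) → p ⊕ p ≡ ⊥
⊕-same []      = refl
⊕-same (b ∷ p) = cong₂ _∷_ (Bool.xor-same b) (⊕-same p)

⊕-cancelˡ : (p q : Subset n) → p ⊕ (p ⊕ q) ≡ q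
⊕-cancelˡ p q = begin
  p ⊕ (p ⊕ q)  ≡⟨ ⊕-assoc p p q ⟨
  p ⊕ p ⊕ q    ≡⟨ cong (_⊕ q) (⊕-same p) ⟩
  ⊥ ⊕ q        ≡⟨ ⊕-identityˡ q ⟩
  q            ∎
  where open ≡-Reasoning

⊕-cancelʳ : (p q : Subset n) → p ⊕ (q ⊕ p) ≡ q
⊕-cancelʳ p q = trans (cong (p ⊕_) (⊕-comm q p)) (⊕-cancelˡ p q)

⊕-interchange : (p q r s : Subset n) → (p ⊕ q) ⊕ (r ⊕ s) ≡ (p ⊕ r) ⊕ (q ⊕ s)
⊕-interchange p q r s = begin
  (p ⊕ q) ⊕ (r ⊕ s)  ≡⟨ ⊕-assoc p q (r ⊕ s) ⟩
  p ⊕ (q ⊕ (r ⊕ s))  ≡⟨ cong (p ⊕_) (⊕-assoc q r s) ⟨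
  p ⊕ (q ⊕ r ⊕ s)    ≡⟨ cong (λ t → p ⊕ (t ⊕ s)) (⊕-comm q r) ⟩
  p ⊕ (r ⊕ q ⊕ s)    ≡⟨ cong (p ⊕_) (⊕-assoc r q s) ⟩
  p ⊕ (r ⊕ (q ⊕ s))  ≡⟨ ⊕-assoc p r (q ⊕ s) ⟨
  (p ⊕ r) ⊕ (q ⊕ s)  ∎
  where open ≡-Reasoning

∩-distribʳ-⊕ : (r p q : Subset n) → (p ⊕ q) ∩ r ≡ (p ∩ r) ⊕ (q ∩ r)
∩-distribʳ-⊕ []      []      []      = refl
∩-distribʳ-⊕ (c ∷ r) (a ∷ p) (b ∷ q) = cong₂ _∷_ (Bool.∧-distribʳ-xor c a b) (∩-distribʳ-⊕ r p q)

∈-⊕⁻ : ∀ (p q : Subset n) {x} → x ∈ p ⊕ q → x ∈ p ⊎ x ∈ q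
∈-⊕⁻ p q {x} x∈ with x ∈? p
... | yes x∈p = inj₁ x∈p
... | no  x∉p = inj₂ (lookup⇒[]= x q (begin
  lookup q x                  ≡⟨ cong (_xor lookup q x) (∉⇒lookup x∉p) ⟨
  lookup p x xor lookup q x   ≡⟨ lookup-⊕ p q x ⟨
  lookup (p ⊕ q) x            ≡⟨ ∈⇒lookup x∈ ⟩
  true                        ∎))
  where open ≡-Reasoning

-- Brings disjoint unions, such as the two ends of an edge, into linear form.
∪≡⊕ : (p q : Subset n) → Empty (p ∩ q) → p ∪ q ≡ p ⊕ q
∪≡⊕ []          []          _ = refl
∪≡⊕ (true  ∷ p) (true  ∷ q) e = contradiction (zero , here) e
∪≡⊕ (true  ∷ p) (false ∷ q) e = cong (true  ∷_) (∪≡⊕ p q λ (x , x∈) → e (suc x , there x∈))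
∪≡⊕ (false ∷ p) (b     ∷ q) e = cong (b ∷_)     (∪≡⊕ p q λ (x , x∈) → e (suc x , there x∈))

∣p⊕q∣≤∣p∣+∣q∣ : (p q : Subset n) → ∣ p ⊕ q ∣ ℕ.≤ ∣ p ∣ ℕ.+ ∣ q ∣
∣p⊕q∣≤∣p∣+∣q∣ []          []          = ℕ.z≤n
∣p⊕q∣≤∣p∣+∣q∣ (false ∷ p) (false ∷ q) = ∣p⊕q∣≤∣p∣+∣q∣ p q
∣p⊕q∣≤∣p∣+∣q∣ (false ∷ p) (true  ∷ q) =
  ℕ.≤-trans (ℕ.s≤s (∣p⊕q∣≤∣p∣+∣q∣ p q)) (ℕ.≤-reflexive (sym (ℕ.+-suc ∣ p ∣ ∣ q ∣)))
∣p⊕q∣≤∣p∣+∣q∣ (true  ∷ p) (false ∷ q) = ℕ.s≤s (∣p⊕q∣≤∣p∣+∣q∣ p q)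
∣p⊕q∣≤∣p∣+∣q∣ (true  ∷ p) (true  ∷ q) =
  ℕ.≤-trans (∣p⊕q∣≤∣p∣+∣q∣ p q) (ℕ.+-mono-≤ (ℕ.n≤1+n ∣ p ∣) (ℕ.n≤1+n ∣ q ∣))

∣p∪q∣≤∣p∣+∣q∣ : (p q : Subset n) → ∣ p ∪ q ∣ ℕ.≤ ∣ p ∣ ℕ.+ ∣ q ∣
∣p∪q∣≤∣p∣+∣q∣ []          []          = ℕ.z≤n
∣p∪q∣≤∣p∣+∣q∣ (false ∷ p) (false ∷ q) = ∣p∪q∣≤∣p∣+∣q∣ p q
∣p∪q∣≤∣p∣+∣q∣ (false ∷ p) (true  ∷ q) =
  ℕ.≤-trans (ℕ.s≤s (∣p∪q∣≤∣p∣+∣q∣ p q)) (ℕ.≤-reflexive (sym (ℕ.+-suc ∣ p ∣ ∣ q ∣)))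
∣p∪q∣≤∣p∣+∣q∣ (true  ∷ p) (b     ∷ q) =
  ℕ.s≤s (ℕ.≤-trans (∣p∪q∣≤∣p∣+∣q∣ p q) (ℕ.+-monoʳ-≤ ∣ p ∣ (∣p∣≤∣x∷p∣ b q)))

∣p∣≡∣p∩q∣+∣p∩∁q∣ : (p q : Subset n) → ∣ p ∣ ≡ ∣ p ∩ q ∣ ℕ.+ ∣ p ∩ ∁ q ∣
∣p∣≡∣p∩q∣+∣p∩∁q∣ []          []          = refl
∣p∣≡∣p∩q∣+∣p∩∁q∣ (false ∷ p) (b     ∷ q) = ∣p∣≡∣p∩q∣+∣p∩∁q∣ p q
∣p∣≡∣p∩q∣+∣p∩∁q∣ (true  ∷ p) (true  ∷ q) = cong ℕ.suc (∣p∣≡∣p∩q∣+∣p∩∁q∣ p q)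
∣p∣≡∣p∩q∣+∣p∩∁q∣ (true  ∷ p) (false ∷ q) =
  trans (cong ℕ.suc (∣p∣≡∣p∩q∣+∣p∩∁q∣ p q)) (sym (ℕ.+-suc ∣ p ∩ q ∣ ∣ p ∩ ∁ q ∣))

p⊆q⇒p∩q≡p : ∀ {p q : Subset n} → p ⊆ q → p ∩ q ≡ p
p⊆q⇒p∩q≡p {p = p} {q} p⊆q = ⊆-antisym (p∩q⊆p p q) (λ x∈p → x∈p∩q⁺ (x∈p , p⊆q x∈p))

-- Makes the deletion of `x c` in the odd case of the decoder a linear operation, so that it can
-- cancel later.
p-x≡p⊕⁅x⁆ : ∀ (p : Subset n) {x} → x ∈ p → p - x ≡ p ⊕ ⁅ x ⁆
p-x≡p⊕⁅x⁆ (_ ∷ p) here = cong (false ∷_) (trans (p─⊥≡p p) (sym (⊕-identityʳ p)))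
p-x≡p⊕⁅x⁆ (true  ∷ p) (there x∈p) = cong (true ∷_) (p-x≡p⊕⁅x⁆ p x∈p)
p-x≡p⊕⁅x⁆ (false ∷ p) (there x∈p) = cong (false ∷_) (p-x≡p⊕⁅x⁆ p x∈p)

-- Iterated symmetric differences.

⨁-map : (φ : Subset m → Subset n) → φ ⊥ ≡ ⊥ → (∀ p q → φ (p ⊕ q) ≡ φ p ⊕ φ q) →
        ∀ (J : Subset k) g → φ (⨁ J g) ≡ ⨁ J (φ ∘ g)
⨁-map φ φ⊥ φ⊕ []      g = φ⊥
⨁-map φ φ⊥ φ⊕ (b ∷ J) g =
  trans (φ⊕ _ _) (cong₂ _⊕_ (φ-if b) (⨁-map φ φ⊥ φ⊕ J (g ∘ suc)))
  where
  φ-if : ∀ b → φ (if b then g zero else ⊥) ≡ (if b then φ (g zero) else ⊥)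
  φ-if true  = refl
  φ-if false = φ⊥

⨁-⊥ : (g : Fin k → Subset n) → ⨁ ⊥ g ≡ ⊥
⨁-⊥ {k = ℕ.zero}  g = refl
⨁-⊥ {k = ℕ.suc k} g = trans (⊕-identityˡ _) (⨁-⊥ (g ∘ suc))

⨁-⊕ : ∀ (J K : Subset k) (g : Fin k → Subset n) → ⨁ (J ⊕ K) g ≡ ⨁ J g ⊕ ⨁ K g
⨁-⊕ []      []      g = sym (⊕-identityˡ ⊥)
⨁-⊕ (a ∷ J) (b ∷ K) g =
  trans (cong₂ _⊕_ (if-⊕ a b) (⨁-⊕ J K (g ∘ suc))) (⊕-interchange _ _ _ _)
  where
  if-⊕ : ∀ a b → (if a xor b then g zero else ⊥) ≡ (if a then g zero else ⊥) ⊕ (if b then g zero else ⊥)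
  if-⊕ true  true  = sym (⊕-same _)
  if-⊕ true  false = sym (⊕-identityʳ _)
  if-⊕ false _     = sym (⊕-identityˡ _)

⨁-pointwise-⊕ : ∀ (J : Subset k) (f g : Fin k → Subset n) → ⨁ J (λ j → f j ⊕ g j) ≡ ⨁ J f ⊕ ⨁ J g
⨁-pointwise-⊕ []          f g = sym (⊕-identityˡ ⊥)
⨁-pointwise-⊕ (true  ∷ J) f g =
  trans (cong (f zero ⊕ g zero ⊕_) (⨁-pointwise-⊕ J (f ∘ suc) (g ∘ suc))) (⊕-interchange _ _ _ _)
⨁-pointwise-⊕ (false ∷ J) f g =
  trans (cong (⊥ ⊕_) (⨁-pointwise-⊕ J (f ∘ suc) (g ∘ suc)))
        (trans (cong (_⊕ (⨁ J (f ∘ suc) ⊕ ⨁ J (g ∘ suc))) (sym (⊕-identityˡ ⊥))) (⊕-interchange _ _ _ _))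

⨁-cong : ∀ (J : Subset k) {f g : Fin k → Subset n} → (∀ {j} → j ∈ J → f j ≡ g j) → ⨁ J f ≡ ⨁ J g
⨁-cong []          f≗g = refl
⨁-cong (true  ∷ J) f≗g = cong₂ _⊕_ (f≗g here) (⨁-cong J (f≗g ∘ there))
⨁-cong (false ∷ J) f≗g = cong (⊥ ⊕_) (⨁-cong J (f≗g ∘ there))

⨁-const-⊥ : (J : Subset k) → ⨁ J (const (⊥ {n})) ≡ ⊥
-- The zero map on the subsets of `Fin 0` is linear, so `⨁-map` applies to it.
⨁-const-⊥ J = sym (⨁-map (const ⊥) refl (λ _ _ → sym (⊕-identityˡ ⊥)) J (const (⊥ {0})))

∈-⨁⁻ : ∀ (J : Subset k) (g : Fin k → Subset n) {x} → x ∈ ⨁ J g → ∃ λ j → j ∈ J × x ∈ g j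
∈-⨁⁻ []      g x∈ = contradiction x∈ ∉⊥
∈-⨁⁻ (b ∷ J) g x∈ with b | ∈-⊕⁻ (if b then g zero else ⊥) (⨁ J (g ∘ suc)) x∈
... | true  | inj₁ x∈g = zero , here , x∈g
... | false | inj₁ x∈⊥ = contradiction x∈⊥ ∉⊥
... | _     | inj₂ x∈⨁ with ∈-⨁⁻ J (g ∘ suc) x∈⨁
...   | j , j∈J , x∈g = suc j , there j∈J , x∈g

⨁-⁅⁆ : ∀ (i : Fin k) (g : Fin k → Subset n) → ⨁ ⁅ i ⁆ g ≡ g i
⨁-⁅⁆ zero    g = trans (cong (g zero ⊕_) (⨁-⊥ (g ∘ suc))) (⊕-identityʳ _)
⨁-⁅⁆ (suc i) g = trans (⊕-identityˡ _) (⨁-⁅⁆ i (g ∘ suc))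

⨁-singletons : (J : Subset k) → ⨁ J ⁅_⁆ ≡ J
⨁-singletons []      = refl
⨁-singletons (b ∷ J) = begin
  (if b then ⁅ zero ⁆ else ⊥) ⊕ ⨁ J (⁅_⁆ ∘ suc)
    -- Here `⁅ suc j ⁆` is `false ∷ ⁅ j ⁆`, and prepending `false` is linear.
    ≡⟨ cong₂ _⊕_ (head b) (sym (⨁-map (false ∷_) refl (λ _ _ → refl) J ⁅_⁆)) ⟩
  (b ∷ ⊥) ⊕ (false ∷ ⨁ J ⁅_⁆)
    ≡⟨ cong₂ _∷_ (Bool.xor-identityʳ b) (trans (⊕-identityˡ _) (⨁-singletons J)) ⟩
  b ∷ J                                          ∎
  where
  open ≡-Reasoning
  head : ∀ b → (if b then ⁅ zero ⁆ else ⊥) ≡ b ∷ ⊥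
  head true  = refl
  head false = refl

⨁-single : ∀ (i : Fin k) (g : Fin k → Subset n) → (∀ {j} → j ≢ i → g j ≡ ⊥) → ⨁ ⊤ g ≡ g i
⨁-single {k = ℕ.suc k} zero g g≡⊥ =
  trans (cong (g zero ⊕_) (trans (⨁-cong (⊤ {k}) (λ _ → g≡⊥ λ ())) (⨁-const-⊥ (⊤ {k})))) (⊕-identityʳ _)
⨁-single (suc i) g g≡⊥ =
  trans (cong₂ _⊕_ (g≡⊥ λ ()) (⨁-single i (g ∘ suc) (λ j≢i → g≡⊥ (j≢i ∘ suc-injective))))
        (⊕-identityˡ _)

∣⨁∣≤ : ∀ {b} (J : Subset k) (g : Fin k → Subset n) → (∀ j → ∣ g j ∣ ℕ.≤ b) → ∣ ⨁ J g ∣ ℕ.≤ k ℕ.* b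
∣⨁∣≤ {n = n} []      g g≤b = ℕ.≤-reflexive (∣⊥∣≡0 n)
∣⨁∣≤ {n = n} {b} (c ∷ J) g g≤b =
  ℕ.≤-trans (∣p⊕q∣≤∣p∣+∣q∣ (if c then g zero else ⊥) _) (ℕ.+-mono-≤ (if≤ c) (∣⨁∣≤ J (g ∘ suc) (g≤b ∘ suc)))
  where
  if≤ : ∀ c → ∣ if c then g zero else ⊥ ∣ ℕ.≤ b
  if≤ true  = g≤b zero
  if≤ false = ℕ.≤-trans (ℕ.≤-reflexive (∣⊥∣≡0 n)) ℕ.z≤n

-- Induction on the number of parts: `E zero` is charged to `X ∩ B zero` and the rest to
-- `X ∩ ∁ (B zero)`, which by disjointness loses nothing of the other parts. Applied with `X` an
-- optimal correction and `B` the blocks.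
∣⨁∣≤-partition : ∀ (X : Subset n) (B E : Fin k → Subset n) →
                 (∀ {i j x} → x ∈ B i → x ∈ B j → i ≡ j) →
                 (∀ i → ∣ E i ∣ ℕ.≤ ∣ X ∩ B i ∣) → ∣ ⨁ ⊤ E ∣ ℕ.≤ ∣ X ∣
∣⨁∣≤-partition {n = n} {k = ℕ.zero}  X B E disjoint E≤ = ℕ.≤-trans (ℕ.≤-reflexive (∣⊥∣≡0 n)) ℕ.z≤n
∣⨁∣≤-partition {k = ℕ.suc k} X B E disjoint E≤ = begin
  ∣ E zero ⊕ ⨁ ⊤ (E ∘ suc) ∣                   ≤⟨ ∣p⊕q∣≤∣p∣+∣q∣ (E zero) _ ⟩
  ∣ E zero ∣ ℕ.+ ∣ ⨁ ⊤ (E ∘ suc) ∣             ≤⟨ ℕ.+-mono-≤ (E≤ zero) rest ⟩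
  ∣ X ∩ B zero ∣ ℕ.+ ∣ X ∩ ∁ (B zero) ∣        ≡⟨ ∣p∣≡∣p∩q∣+∣p∩∁q∣ X (B zero) ⟨
  ∣ X ∣                                        ∎
  where
  open ℕ.≤-Reasoning
  shrink : ∀ i → X ∩ B (suc i) ⊆ (X ∩ ∁ (B zero)) ∩ B (suc i)
  shrink i x∈ with x∈p∩q⁻ X (B (suc i)) x∈
  ... | x∈X , x∈B = x∈p∩q⁺ (x∈p∩q⁺ (x∈X , x∉p⇒x∈∁p λ x∈B₀ → contradiction (disjoint x∈B₀ x∈B) λ ()) , x∈B)
  rest : ∣ ⨁ ⊤ (E ∘ suc) ∣ ℕ.≤ ∣ X ∩ ∁ (B zero) ∣
  rest = ∣⨁∣≤-partition (X ∩ ∁ (B zero)) (B ∘ suc) (E ∘ suc)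
           (λ x∈i x∈j → suc-injective (disjoint x∈i x∈j))
           (λ i → ℕ.≤-trans (E≤ (suc i)) (p⊆q⇒∣p∣≤∣q∣ (shrink i)))

-- Parity of cardinalities, and linearity of `oddlyCovered`.

parity : ℕ → Bool
-- The same Boolean that `oddlyCovered` tabulates.
parity i = does (i % 2 ℕ.≟ 1)

parity-suc : ∀ i → parity (ℕ.suc i) ≡ not (parity i)
parity-suc ℕ.zero            = refl
parity-suc (ℕ.suc ℕ.zero)    = refl
parity-suc (ℕ.suc (ℕ.suc i)) = parity-suc i

parity≡true⇒Odd : ∀ i → parity i ≡ true → Odd i
parity≡true⇒Odd (ℕ.suc ℕ.zero)    _ = refl
parity≡true⇒Odd (ℕ.suc (ℕ.suc i)) p = parity≡true⇒Odd i p

parity≡false⇒Even : ∀ i → parity i ≡ false → Even i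
parity≡false⇒Even ℕ.zero            _ = refl
parity≡false⇒Even (ℕ.suc (ℕ.suc i)) p = parity≡false⇒Even i p

parity-⊕ : (p q : Subset n) → parity ∣ p ⊕ q ∣ ≡ parity ∣ p ∣ xor parity ∣ q ∣
parity-⊕ []          []          = refl
parity-⊕ (false ∷ p) (false ∷ q) = parity-⊕ p q
parity-⊕ (false ∷ p) (true  ∷ q)
  rewrite parity-suc ∣ p ⊕ q ∣ | parity-suc ∣ q ∣ | parity-⊕ p q = Bool.not-distribʳ-xor (parity ∣ p ∣) _
parity-⊕ (true  ∷ p) (false ∷ q)
  rewrite parity-suc ∣ p ⊕ q ∣ | parity-suc ∣ p ∣ | parity-⊕ p q = Bool.not-distribˡ-xor (parity ∣ p ∣) _
parity-⊕ (true  ∷ p) (true  ∷ q)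
  rewrite parity-suc ∣ p ∣ | parity-suc ∣ q ∣ | parity-⊕ p q = sym (Bool.xor-annihilates-not (parity ∣ p ∣) _)

parity-⁅⁆ : (x : Fin n) → parity ∣ ⁅ x ⁆ ∣ ≡ true
parity-⁅⁆ x = cong parity (∣⁅x⁆∣≡1 x)

-- Equal summands cancel in pairs. This removes the root from the sum of paths in `join`.
⨁-const : (J : Subset k) (p : Subset n) → ⨁ J (const p) ≡ (if parity ∣ J ∣ then p else ⊥)
⨁-const []          p = refl
⨁-const (false ∷ J) p = trans (⊕-identityˡ _) (⨁-const J p)
⨁-const (true  ∷ J) p rewrite ⨁-const J p | parity-suc ∣ J ∣ with parity ∣ J ∣
... | true  = ⊕-same p
... | false = ⊕-identityʳ p

-- Each summand meets `Y` in a single point and so flips the parity once. In the application `X` is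
-- `corners` and `Y` a color class.
parity-⨁ : ∀ (J : Subset k) (X : Fin k → Subset n) Y → (∀ j → ∣ X j ∩ Y ∣ ≡ 1) →
           parity ∣ ⨁ J X ∩ Y ∣ ≡ parity ∣ J ∣
parity-⨁ {n = n} [] X Y odd = cong parity (trans (cong ∣_∣ (∩-zeroˡ Y)) (∣⊥∣≡0 n))
parity-⨁ {n = n} (b ∷ J) X Y odd = begin
  parity ∣ (head ⊕ tail) ∩ Y ∣
    ≡⟨ cong (parity ∘ ∣_∣) (∩-distribʳ-⊕ Y head tail) ⟩
  parity ∣ (head ∩ Y) ⊕ (tail ∩ Y) ∣                 ≡⟨ parity-⊕ (head ∩ Y) (tail ∩ Y) ⟩
  parity ∣ head ∩ Y ∣ xor parity ∣ tail ∩ Y ∣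
    ≡⟨ cong₂ _xor_ (parity-head b) (parity-⨁ J (X ∘ suc) Y (odd ∘ suc)) ⟩
  b xor parity ∣ J ∣                                 ≡⟨ xor-∷ b ⟩
  parity ∣ b ∷ J ∣                                   ∎
  where
  open ≡-Reasoning
  head = if b then X zero else ⊥
  tail = ⨁ J (X ∘ suc)
  parity-head : ∀ b → parity ∣ (if b then X zero else ⊥) ∩ Y ∣ ≡ b
  parity-head true  = cong parity (odd zero)
  parity-head false = cong parity (trans (cong ∣_∣ (∩-zeroˡ Y)) (∣⊥∣≡0 n))
  xor-∷ : ∀ b → b xor parity ∣ J ∣ ≡ parity ∣ b ∷ J ∣
  xor-∷ true  = sym (parity-suc ∣ J ∣)
  xor-∷ false = refl

-- Replaces counting mod 2 by a linear combination over 𝔽₂; the linearity of both `syndrome` and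
-- `oddDegree` comes from here.
oddlyCovered≡⨁ : ∀ (X : Fin k → Subset n) J → oddlyCovered X J ≡ ⨁ J X
oddlyCovered≡⨁ X J = lookup-ext λ v → trans (lookup∘tabulate _ v) (pointwise X J v)
  where
  pointwise : ∀ {k n} (X : Fin k → Subset n) J v →
              parity ∣ J ∩ subset (λ i → v ∈? X i) ∣ ≡ lookup (⨁ J X) v
  pointwise X []          v = sym (lookup-replicate v false)
  pointwise X (false ∷ J) v = trans (pointwise (X ∘ suc) J v) (cong (λ p → lookup p v) (sym (⊕-identityˡ _)))
  pointwise X (true  ∷ J) v
    rewrite lookup-⊕ (X zero) (⨁ J (X ∘ suc)) v
          | sym (pointwise (X ∘ suc) J v) | sym (does-∈? v (X zero)) with does (v ∈? X zero)
  ... | true  = parity-suc ∣ J ∩ subset (λ i → v ∈? X (suc i)) ∣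
  ... | false = refl

module _ (X : Fin k → Subset n) where

  oddlyCovered-⊥ : oddlyCovered X ⊥ ≡ ⊥
  oddlyCovered-⊥ = trans (oddlyCovered≡⨁ X ⊥) (⨁-⊥ X)

  oddlyCovered-⊕ : ∀ J K → oddlyCovered X (J ⊕ K) ≡ oddlyCovered X J ⊕ oddlyCovered X K
  oddlyCovered-⊕ J K = begin
    oddlyCovered X (J ⊕ K)                 ≡⟨ oddlyCovered≡⨁ X (J ⊕ K) ⟩
    ⨁ (J ⊕ K) X                            ≡⟨ ⨁-⊕ J K X ⟩
    ⨁ J X ⊕ ⨁ K X                          ≡⟨ cong₂ _⊕_ (oddlyCovered≡⨁ X J) (oddlyCovered≡⨁ X K) ⟨
    oddlyCovered X J ⊕ oddlyCovered X K    ∎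
    where open ≡-Reasoning

  oddlyCovered-⨁ : ∀ (J : Subset m) g → oddlyCovered X (⨁ J g) ≡ ⨁ J (oddlyCovered X ∘ g)
  oddlyCovered-⨁ = ⨁-map (oddlyCovered X) oddlyCovered-⊥ oddlyCovered-⊕

  oddlyCovered-⁅⁆ : ∀ i → oddlyCovered X ⁅ i ⁆ ≡ X i
  oddlyCovered-⁅⁆ i = trans (oddlyCovered≡⨁ X ⁅ i ⁆) (⨁-⁅⁆ i X)

  ∈-oddlyCovered⁻ : ∀ J {x} → x ∈ oddlyCovered X J → ∃ λ j → j ∈ J × x ∈ X j
  ∈-oddlyCovered⁻ J x∈ = ∈-⨁⁻ J X (subst (_ ∈_) (oddlyCovered≡⨁ X J) x∈)

-- Reachability and connected components of finite relations.

module _ {_~_ : Rel (Fin n) 0ℓ} (_~?_ : Decidable _~_) where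

  -- A set of points known to be reachable is enlarged by one step at a time; its complement
  -- shrinks, so this ends. When no step leads out, the set is closed under `_~_` and hence contains
  -- everything reachable.
  reachable : ∀ a → ∃ λ Y → ∀ b → b ∈ Y ⇔ Star _~_ a b
  reachable a = grow ⁅ a ⁆ (x∈⁅x⁆ a) (λ b∈ → subst (Star _~_ a) (sym (x∈⁅y⁆⇒x≡y a b∈)) ε) (<-wellFounded _)
    where
    grow : ∀ Y → a ∈ Y → (∀ {b} → b ∈ Y → Star _~_ a b) → Acc ℕ._<_ ∣ ∁ Y ∣ →
           ∃ λ Y → ∀ b → b ∈ Y ⇔ Star _~_ a b
    grow Y a∈Y sound (acc rec)
      with any? (λ x → any? λ y → (x ∈? Y) ×-dec ¬? (y ∈? Y) ×-dec (x ~? y))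
    ... | yes (x , y , x∈Y , y∉Y , x~y) =
          grow (Y ∪ ⁅ y ⁆) (p⊆p∪q ⁅ y ⁆ a∈Y) sound′
               (rec (p⊂q⇒∣p∣<∣q∣ (p⊂q⇒∁p⊃∁q (p⊆p∪q ⁅ y ⁆ , y , q⊆p∪q Y ⁅ y ⁆ (x∈⁅x⁆ y) , y∉Y))))
          where
          sound′ : ∀ {b} → b ∈ Y ∪ ⁅ y ⁆ → Star _~_ a b
          sound′ b∈ with x∈p∪q⁻ Y ⁅ y ⁆ b∈
          ... | inj₁ b∈Y = sound b∈Y
          ... | inj₂ b∈y rewrite x∈⁅y⁆⇒x≡y y b∈y = sound x∈Y ◅◅ x~y ◅ ε
    ... | no stuck = Y , λ b → mk⇔ sound (closed a∈Y)
          where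
          closed : ∀ {x b} → x ∈ Y → Star _~_ x b → b ∈ Y
          closed x∈Y ε = x∈Y
          closed {x} x∈Y (_◅_ {j = y} x~y y~*b) with y ∈? Y
          ... | yes y∈Y = closed y∈Y y~*b
          ... | no  y∉Y = contradiction (x , y , x∈Y , y∉Y , x~y) stuck

  Star? : Decidable (Star _~_)
  Star? a b with reachable a
  ... | Y , spec = map′ (Equivalence.to (spec b)) (Equivalence.from (spec b)) (b ∈? Y)

module _ (X : Subset n) {_~_ : Rel (Fin n) 0ℓ} (_~?_ : Decidable _~_) where

  Step? : Decidable (λ a b → a ∈ X × b ∈ X × a ~ b)
  Step? a b = (a ∈? X) ×-dec (b ∈? X) ×-dec (a ~? b)

  -- Lets a minimum be taken over the connected edge sets in `spanningTree`.
  Connected? : Dec (Connected X _~_)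
  Connected? = map′ (λ c {a} {b} → c a b) (λ c a b → c {a} {b})
    (all? λ a → all? λ b → (a ∈? X) →-dec (b ∈? X) →-dec Star? Step? a b)

  componentOf : ∀ {a} → a ∈ X → ∃ λ Y → IsComponent X _~_ Y × a ∈ Y
  componentOf {a} a∈X with reachable Step? a
  ... | Y , spec = Y , (a , a∈X , spec) , Equivalence.from (spec a) ε

  -- Every point of `X` is taken as a root and repetitions are then removed: roots of one component
  -- give equal subsets, since `IsComponent` determines the members relative to the root.
  components : ∃ λ (Ys : List (Subset n)) → Unique Ys × (∀ Y → Y ∈ˡ Ys ⇔ IsComponent X _~_ Y)
  components = Ys , deduplicate-! _≟ˢ_ _ , λ Y → mk⇔ (sound Y) (complete Y)
    where
    component : Fin n → Subset n
    component a = proj₁ (reachable Step? a)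
    roots = filter (_∈? X) (allFin n)
    Ys    = deduplicate _≟ˢ_ (List.map component roots)
    sound : ∀ Y → Y ∈ˡ Ys → IsComponent X _~_ Y
    sound Y Y∈ with ∈-map⁻ component (∈-deduplicate⁻ _≟ˢ_ (List.map component roots) Y∈)
    ... | a , a∈ , refl = a , proj₂ (∈-filter⁻ (_∈? X) {xs = allFin n} a∈) , proj₂ (reachable Step? a)
    complete : ∀ Y → IsComponent X _~_ Y → Y ∈ˡ Ys
    complete Y (a , a∈X , spec) = subst (_∈ˡ Ys) (sym Y≡)
      (∈-deduplicate⁺ _≟ˢ_ (∈-map⁺ component (∈-filter⁺ (_∈? X) (∈-allFin a) a∈X)))
      where
      spec′ = proj₂ (reachable Step? a)
      Y≡ : Y ≡ component a
      Y≡ = ⊆-antisym (λ {b} → Equivalence.from (spec′ b) ∘ Equivalence.to (spec b))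
                     (λ {b} → Equivalence.from (spec b) ∘ Equivalence.to (spec′ b))

module _ {X : Subset n} {_~_ : Rel (Fin n) 0ℓ} where

  component-⊆ : ∀ {Y} → IsComponent X _~_ Y → Y ⊆ X
  component-⊆ (a , a∈X , spec) {b} b∈Y = end a∈X (Equivalence.to (spec b) b∈Y)
    where
    end : ∀ {a b} → a ∈ X → Path X _~_ a b → b ∈ X
    end a∈X ε                    = a∈X
    end a∈X ((_ , j∈X , _) ◅ p)  = end j∈X p

  component-closed : ∀ {Y b c} → IsComponent X _~_ Y → b ∈ Y → c ∈ X → b ~ c → c ∈ Y
  component-closed {b = b} {c} Y-comp@(a , _ , spec) b∈Y c∈X b~c =
    Equivalence.from (spec c) (Equivalence.to (spec b) b∈Y ◅◅ (component-⊆ Y-comp b∈Y , c∈X , b~c) ◅ ε)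

  component-unique : Symmetric _~_ → ∀ {Y Z b} → IsComponent X _~_ Y → IsComponent X _~_ Z →
                     b ∈ Y → b ∈ Z → Y ≡ Z
  component-unique ~-sym Y-comp Z-comp b∈Y b∈Z =
    ⊆-antisym (included Y-comp Z-comp b∈Y b∈Z) (included Z-comp Y-comp b∈Z b∈Y)
    where
    included : ∀ {Y Z b} → IsComponent X _~_ Y → IsComponent X _~_ Z → b ∈ Y → b ∈ Z → Y ⊆ Z
    included {b = b} (_ , _ , specY) (_ , _ , specZ) b∈Y b∈Z {c} c∈Y =
      -- The path runs from the root of `Z` to `b`, back from `b` to the root of `Y`, and on to `c`.
      Equivalence.from (specZ c)
        (Equivalence.to (specZ b) b∈Z ◅◅
         reverse (λ (i∈ , j∈ , i~j) → j∈ , i∈ , ~-sym i~j) (Equivalence.to (specY b) b∈Y) ◅◅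
         Equivalence.to (specY c) c∈Y)

-- Joins and spanning trees in a finite loopless multigraph.

module Graph (src tgt : Fin m → Fin n) (H : Subset n)
             (src≢tgt : ∀ e → src e ≢ tgt e)
             (src∈H : ∀ e → src e ∈ H) (tgt∈H : ∀ e → tgt e ∈ H) where

  Joins : Fin m → Rel (Fin n) 0ℓ
  Joins e u v = (src e ≡ u × tgt e ≡ v) ⊎ (src e ≡ v × tgt e ≡ u)

  Joined : Subset m → Rel (Fin n) 0ℓ
  Joined T u v = ∃ λ e → e ∈ T × Joins e u v

  Joined? : ∀ T → Decidable (Joined T)
  Joined? T u v = any? λ e → (e ∈? T) ×-dec
    (((src e ≟ᶠ u) ×-dec (tgt e ≟ᶠ v)) ⊎-dec ((src e ≟ᶠ v) ×-dec (tgt e ≟ᶠ u)))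

  endpoints : Fin m → Subset n
  endpoints e = ⁅ src e ⁆ ∪ ⁅ tgt e ⁆

  -- The ends differ, so neither cancels. In this form the boundaries of consecutive edges
  -- telescope.
  endpoints≡⊕ : ∀ e → endpoints e ≡ ⁅ src e ⁆ ⊕ ⁅ tgt e ⁆
  endpoints≡⊕ e = ∪≡⊕ ⁅ src e ⁆ ⁅ tgt e ⁆ λ (x , x∈) → let x∈src , x∈tgt = x∈p∩q⁻ ⁅ src e ⁆ ⁅ tgt e ⁆ x∈ in
    src≢tgt e (trans (sym (x∈⁅y⁆⇒x≡y _ x∈src)) (x∈⁅y⁆⇒x≡y _ x∈tgt))

  Joins⇒endpoints : ∀ e {u v} → Joins e u v → endpoints e ≡ ⁅ u ⁆ ⊕ ⁅ v ⁆
  Joins⇒endpoints e (inj₁ (refl , refl)) = endpoints≡⊕ e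
  Joins⇒endpoints e (inj₂ (refl , refl)) = trans (endpoints≡⊕ e) (⊕-comm ⁅ src e ⁆ ⁅ tgt e ⁆)

  Joins⇒∈H : ∀ e {u v} → Joins e u v → u ∈ H × v ∈ H
  Joins⇒∈H e (inj₁ (refl , refl)) = src∈H e , tgt∈H e
  Joins⇒∈H e (inj₂ (refl , refl)) = tgt∈H e , src∈H e

  -- Inner vertices of the path cancel. Edges are added mod 2, so a path that repeats an edge is
  -- harmless.
  pathEdges : ∀ {T u v} → Path H (Joined T) u v → ∃ λ J → J ⊆ T × ⨁ J endpoints ≡ ⁅ u ⁆ ⊕ ⁅ v ⁆
  pathEdges {u = u} ε = ⊥ , ⊥⊆ , trans (⨁-⊥ endpoints) (sym (⊕-same ⁅ u ⁆))
  pathEdges {T} {u} {v} (_◅_ {j = w} (_ , _ , e , e∈T , e-joins) p) with pathEdges p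
  ... | J , J⊆T , ∂J = ⁅ e ⁆ ⊕ J , ⊆T , (begin
    ⨁ (⁅ e ⁆ ⊕ J) endpoints                ≡⟨ ⨁-⊕ ⁅ e ⁆ J endpoints ⟩
    ⨁ ⁅ e ⁆ endpoints ⊕ ⨁ J endpoints
      ≡⟨ cong₂ _⊕_ (trans (⨁-⁅⁆ e endpoints) (Joins⇒endpoints e e-joins)) ∂J ⟩
    (⁅ u ⁆ ⊕ ⁅ w ⁆) ⊕ (⁅ w ⁆ ⊕ ⁅ v ⁆)      ≡⟨ ⊕-assoc ⁅ u ⁆ ⁅ w ⁆ _ ⟩
    ⁅ u ⁆ ⊕ (⁅ w ⁆ ⊕ (⁅ w ⁆ ⊕ ⁅ v ⁆))      ≡⟨ cong (⁅ u ⁆ ⊕_) (⊕-cancelˡ ⁅ w ⁆ ⁅ v ⁆) ⟩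
    ⁅ u ⁆ ⊕ ⁅ v ⁆                          ∎)
    where
    open ≡-Reasoning
    ⊆T : ⁅ e ⁆ ⊕ J ⊆ T
    ⊆T x∈ with ∈-⊕⁻ ⁅ e ⁆ J x∈
    ... | inj₁ x∈e = subst (_∈ T) (sym (x∈⁅y⁆⇒x≡y e x∈e)) e∈T
    ... | inj₂ x∈J = J⊆T x∈J

  -- The sum of the paths from a root to the vertices of X; the root cancels
  -- because X is even.
  join : ∀ {T X} → Connected H (Joined T) → X ⊆ H → parity ∣ X ∣ ≡ false →
         ∃ λ J → J ⊆ T × ⨁ J endpoints ≡ X
  join {T} {X} connected X⊆H X-even with nonempty? X
  ... | no X-empty = ⊥ , ⊥⊆ , trans (⨁-⊥ endpoints) (sym (Empty-unique X-empty))
  ... | yes (r , r∈X) = ⨁ X toRoot , ⊆T , (begin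
    ⨁ (⨁ X toRoot) endpoints
      ≡⟨ ⨁-map (λ J → ⨁ J endpoints) (⨁-⊥ endpoints) (λ J K → ⨁-⊕ J K endpoints) X toRoot ⟩
    ⨁ X (λ x → ⨁ (toRoot x) endpoints)
      ≡⟨ ⨁-cong X (λ {x} x∈X → proj₂ (proj₂ (path x)) (X⊆H x∈X)) ⟩
    ⨁ X (λ x → ⁅ r ⁆ ⊕ ⁅ x ⁆)             ≡⟨ ⨁-pointwise-⊕ X (const ⁅ r ⁆) ⁅_⁆ ⟩
    ⨁ X (const ⁅ r ⁆) ⊕ ⨁ X ⁅_⁆           ≡⟨ cong₂ _⊕_ (⨁-const X ⁅ r ⁆) (⨁-singletons X) ⟩
    (if parity ∣ X ∣ then ⁅ r ⁆ else ⊥) ⊕ X ≡⟨ cong (λ b → (if b then ⁅ r ⁆ else ⊥) ⊕ X) X-even ⟩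
    ⊥ ⊕ X                                 ≡⟨ ⊕-identityˡ X ⟩
    X                                     ∎)
    where
    open ≡-Reasoning
    -- Summation over `X` needs a path for every index; outside `H` the value `⊥` is a default that
    -- no vertex of `X` meets.
    path : ∀ x → ∃ λ J → J ⊆ T × (x ∈ H → ⨁ J endpoints ≡ ⁅ r ⁆ ⊕ ⁅ x ⁆)
    path x with x ∈? H
    ... | yes x∈H = let J , J⊆T , ∂J = pathEdges (connected (X⊆H r∈X) x∈H) in J , J⊆T , λ _ → ∂J
    ... | no  x∉H = ⊥ , ⊥⊆ , λ x∈H → contradiction x∈H x∉H
    toRoot : Fin n → Subset m
    toRoot x = proj₁ (path x)
    ⊆T : ⨁ X toRoot ⊆ T
    ⊆T e∈ with ∈-⨁⁻ X toRoot e∈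
    ... | x , _ , e∈x = proj₁ (proj₂ (path x)) e∈x

  -- A minimum connected edge set is acyclic, since an edge of a cycle can
  -- be bypassed along the rest of the cycle.
  spanningTree : Connected H (Joined ⊤) → ∃ λ T → Connected H (Joined T) × Acyclic (Joined T)
  spanningTree connected⊤ with minimum (λ T → Connected? H (Joined? T)) (⊤ , connected⊤)
  ... | T , connected , least = T , connected , acyclic
    where
    acyclic : Acyclic (Joined T)
    acyclic {v} {v₁ ∷ v₂ ∷ vs} ((v≢v₁ ∷ v≢v₂ ∷ v≢vs) ∷ (v₁≢v₂ ∷ v₁≢vs) ∷ _) _
            ((e , e∈T , e-joins) ∷ (e₁ , e₁∈T , e₁-joins) ∷ cycle) =
      ℕ.<⇒≱ (x∈p⇒∣p-x∣<∣p∣ e∈T) (least (T - e) connected-e)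
      where
      Step : Rel (Fin n) 0ℓ
      Step a b = a ∈ H × b ∈ H × Joined (T - e) a b

      Step-sym : Symmetric Step
      Step-sym (a∈H , b∈H , e′ , e′∈ , e′-joins) = b∈H , a∈H , e′ , e′∈ , swap e′-joins

      e-from : ∀ {a b} → Joins e a b → a ≡ v ⊎ a ≡ v₁
      e-from = only e-joins
        where
        only : ∀ {a b} → Joins e v v₁ → Joins e a b → a ≡ v ⊎ a ≡ v₁
        only (inj₁ (refl , refl)) (inj₁ (refl , refl)) = inj₁ refl
        only (inj₁ (refl , refl)) (inj₂ (refl , refl)) = inj₂ refl
        only (inj₂ (refl , refl)) (inj₁ (refl , refl)) = inj₂ refl
        only (inj₂ (refl , refl)) (inj₂ (refl , refl)) = inj₁ refl

      -- The removed edge `e` has only the ends `v` and `v₁`, so an edge starting at any other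
      -- vertex is different from `e` and survives.
      step : ∀ {a b} → v ≢ a → v₁ ≢ a → Joined T a b → Step a b
      step v≢a v₁≢a (e′ , e′∈T , e′-joins) =
        let a∈H , b∈H = Joins⇒∈H e′ e′-joins in
        a∈H , b∈H , e′ , x∈p∧x≢y⇒x∈p-y e′∈T e′≢e , e′-joins
        where
        e′≢e : e′ ≢ e
        e′≢e refl = [ v≢a ∘ sym , v₁≢a ∘ sym ] (e-from e′-joins)

      walk : ∀ {a} as → All (v ≢_) (a ∷ as) → All (v₁ ≢_) (a ∷ as) →
             Linked (Joined T) (a ∷ (as ∷ʳ v)) → Star Step a v
      walk []       (v≢a ∷ _)    (v₁≢a ∷ _)    (a~v ∷ [-]) = step v≢a v₁≢a a~v ◅ ε
      walk (b ∷ as) (v≢a ∷ v≢as) (v₁≢a ∷ v₁≢as) (a~b ∷ rest) =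
        step v≢a v₁≢a a~b ◅ walk as v≢as v₁≢as rest

      -- The edge from `v₁` to `v₂` is first read backwards, since `step` wants a start away from
      -- both ends of `e`; `v₂` qualifies and `v₁` does not.
      bypass : Star Step v₁ v
      bypass = Step-sym (step v≢v₂ v₁≢v₂ (e₁ , e₁∈T , swap e₁-joins)) ◅
               walk vs (v≢v₂ ∷ v≢vs) (v₁≢v₂ ∷ v₁≢vs) cycle

      replace : ∀ {a b} → a ∈ H × b ∈ H × Joined T a b → Star Step a b
      replace (a∈H , b∈H , e′ , e′∈T , e′-joins) with e′ ≟ᶠ e
      ... | no  e′≢e = (a∈H , b∈H , e′ , x∈p∧x≢y⇒x∈p-y e′∈T e′≢e , e′-joins) ◅ ε
      ... | yes refl = around e-joins e′-joins
        where
        back : Star Step v v₁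
        back = reverse Step-sym bypass
        around : ∀ {a b} → Joins e v v₁ → Joins e a b → Star Step a b
        around (inj₁ (refl , refl)) (inj₁ (refl , refl)) = back
        around (inj₁ (refl , refl)) (inj₂ (refl , refl)) = bypass
        around (inj₂ (refl , refl)) (inj₁ (refl , refl)) = bypass
        around (inj₂ (refl , refl)) (inj₂ (refl , refl)) = back

      connected-e : Connected H (Joined (T - e))
      connected-e a∈H b∈H = kleisliStar id replace (connected a∈H b∈H)
    acyclic {v} {_ ∷ []} _ (ℕ.s≤s ())

-- Turns the duplicate-free list of components into the injective family required by `Blocks`.
Unique⇒lookup-injective : ∀ {A : Set} {xs : List A} → Unique xs → ∀ {i j} →
                          List.lookup xs i ≡ List.lookup xs j → i ≡ j
Unique⇒lookup-injective (_ ∷ _)   {zero}  {zero}  _  = refl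
Unique⇒lookup-injective (x∉ ∷ _)  {zero}  {suc j} eq = contradiction eq (All.lookup x∉ (∈-lookup j))
Unique⇒lookup-injective (x∉ ∷ _)  {suc i} {zero}  eq = contradiction (sym eq) (All.lookup x∉ (∈-lookup i))
Unique⇒lookup-injective (_ ∷ xs!) {suc i} {suc j} eq = cong suc (Unique⇒lookup-injective xs! eq)

-- Color classes and the syndrome.

overColors : (Color → Subset n) → Subset n
-- The order and association of `moves`, so that `moves J` has this shape by definition.
overColors g = g red ⊕ g green ⊕ g blue

overColors-cong : ∀ {f g : Color → Subset n} → (∀ c → f c ≡ g c) → overColors f ≡ overColors g
overColors-cong f≗g = cong₂ _⊕_ (cong₂ _⊕_ (f≗g red) (f≗g green)) (f≗g blue)

overColors-⊕ : ∀ (f g : Color → Subset n) → overColors (λ c → f c ⊕ g c) ≡ overColors f ⊕ overColors g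
overColors-⊕ f g =
  trans (cong (_⊕ (f blue ⊕ g blue)) (⊕-interchange (f red) (g red) (f green) (g green)))
        (⊕-interchange (f red ⊕ f green) (g red ⊕ g green) (f blue) (g blue))

module Lattice (L : ColorCodeLattice) where
  open ColorCodeLattice L

  -- The color classes partition the vertices, so exactly one of the three summands can see a given
  -- vertex.
  byColor : ∀ p → overColors (λ c → p ∩ V[ c ]) ≡ p
  byColor p = lookup-ext λ v → let b = lookup p v in begin
    lookup (overColors (λ c → p ∩ V[ c ])) v
      ≡⟨ trans (lookup-⊕ (p ∩ V[ red ] ⊕ p ∩ V[ green ]) (p ∩ V[ blue ]) v)
               (cong (_xor lookup (p ∩ V[ blue ]) v) (lookup-⊕ (p ∩ V[ red ]) (p ∩ V[ green ]) v)) ⟩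
    (lookup (p ∩ V[ red ]) v xor lookup (p ∩ V[ green ]) v) xor lookup (p ∩ V[ blue ]) v
      ≡⟨ cong₂ _xor_ (cong₂ _xor_ (lookup-∩V v red) (lookup-∩V v green)) (lookup-∩V v blue) ⟩
    ((b ∧ does (color v ≟ᶜ red)) xor (b ∧ does (color v ≟ᶜ green))) xor (b ∧ does (color v ≟ᶜ blue))
      ≡⟨ one-color b (color v) ⟩
    b ∎
    where
    open ≡-Reasoning
    lookup-∩V : ∀ v c → lookup (p ∩ V[ c ]) v ≡ lookup p v ∧ does (color v ≟ᶜ c)
    lookup-∩V v c = trans (lookup-zipWith _∧_ v p V[ c ]) (cong (lookup p v ∧_) (lookup∘tabulate _ v))
    one-color : ∀ b c → ((b ∧ does (c ≟ᶜ red)) xor (b ∧ does (c ≟ᶜ green))) xor (b ∧ does (c ≟ᶜ blue)) ≡ b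
    one-color false red   = refl
    one-color false green = refl
    one-color false blue  = refl
    one-color true  red   = refl
    one-color true  green = refl
    one-color true  blue  = refl

  corners∩V : ∀ f c → corners f ∩ V[ c ] ≡ ⁅ corner f c ⁆
  corners∩V f c with tricolored f c
  ... | v , (v∈f , v-colored) , unique = ⊆-antisym ⊆⁅v⁆ ⊇⁅v⁆
    where
    color? = λ u → color u ≟ᶜ c
    ⊆⁅v⁆ : corners f ∩ V[ c ] ⊆ ⁅ v ⁆
    ⊆⁅v⁆ u∈ with x∈p∩q⁻ (corners f) V[ c ] u∈
    ... | u∈f , u∈V rewrite sym (unique (u∈f , ∈-subset⁻ color? u∈V)) = x∈⁅x⁆ v
    ⊇⁅v⁆ : ⁅ v ⁆ ⊆ corners f ∩ V[ c ]
    ⊇⁅v⁆ u∈ rewrite x∈⁅y⁆⇒x≡y v u∈ = x∈p∩q⁺ (v∈f , ∈-subset⁺ color? v-colored)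

  -- Every face has one corner of color `c`. As the right side does not mention `c`, the three color
  -- parities of a syndrome agree, and the two cases of the decoder are exhaustive.
  parity-syndrome : ∀ D c → parity ∣ syndrome D ∩ V[ c ] ∣ ≡ parity ∣ D ∣
  parity-syndrome D c = trans
    (cong (λ p → parity ∣ p ∩ V[ c ] ∣) (oddlyCovered≡⨁ corners D))
    (parity-⨁ D corners V[ c ] λ f → trans (cong ∣_∣ (corners∩V f c)) (∣⁅x⁆∣≡1 (corner f c)))

  Adjacent-sym : Symmetric Adjacent
  Adjacent-sym (v , v∈f , v∈g) = v , v∈g , v∈f

  ∈-vertices⁺ : ∀ {X f v} → f ∈ X → v ∈ corners f → v ∈ vertices X
  ∈-vertices⁺ {X} f∈X v∈f =
    ∈-subset⁺ (λ v → any? λ f → (f ∈? X) ×-dec (v ∈? corners f)) (_ , f∈X , v∈f)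

  ∈-vertices⁻ : ∀ {X v} → v ∈ vertices X → ∃ λ f → f ∈ X × v ∈ corners f
  ∈-vertices⁻ {X} = ∈-subset⁻ (λ v → any? λ f → (f ∈? X) ×-dec (v ∈? corners f))

-- Blocks and their interior vertices.

module BlockLemmas (L : ColorCodeLattice) (F∂ : Subset (ColorCodeLattice.#F L)) where
  open ColorCodeLattice L
  open Boundary L F∂
  open Lattice L

  blocks : Blocks
  blocks with components Fint Adjacent?
  ... | Bs , Bs! , spec = record
    { q          = length Bs
    ; block      = List.lookup Bs
    ; isBlock    = λ i → Equivalence.to (spec _) (∈-lookup i)
    ; distinct   = Unique⇒lookup-injective Bs!
    ; exhaustive = λ {X} X-block → let X∈Bs = Equivalence.from (spec X) X-block in
                   index X∈Bs , sym (lookup-index X∈Bs)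
    }

  ∉V∂⇒∈Fint : ∀ {v f} → v ∉ V∂ → v ∈ corners f → f ∈ Fint
  ∉V∂⇒∈Fint v∉V∂ v∈f = x∉p⇒x∈∁p λ f∈F∂ → v∉V∂ (∈-vertices⁺ f∈F∂ v∈f)

  -- A face at a vertex off the walls is not a boundary face, and through that vertex it is adjacent
  -- to a face of the block.
  faces-at-interior : ∀ {B v f} → IsBlock B → v ∈ interior B → v ∈ corners f → f ∈ B
  faces-at-interior {B} B-block v∈int v∈f with x∈p∩q⁻ (vertices B) Vint v∈int
  ... | v∈B , v∈Vint with ∈-vertices⁻ v∈B
  ...   | g , g∈B , v∈g =
          component-closed B-block g∈B (∉V∂⇒∈Fint (x∈∁p⇒x∉p v∈Vint) v∈f) (_ , v∈g , v∈f)

  -- Locality: `D` splits into its parts inside and outside `B`, and by `faces-at-interior` no face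
  -- outside `B` touches the interior of `B`.
  syndrome-interior : ∀ {B} D → IsBlock B → syndrome D ∩ interior B ≡ syndrome (D ∩ B) ∩ interior B
  syndrome-interior {B} D B-block = begin
    syndrome D ∩ I
      ≡⟨ cong (λ D → syndrome D ∩ I) (split D B) ⟨
    syndrome ((D ∩ B) ⊕ (D ∩ ∁ B)) ∩ I
      ≡⟨ cong (_∩ I) (oddlyCovered-⊕ corners (D ∩ B) (D ∩ ∁ B)) ⟩
    (syndrome (D ∩ B) ⊕ syndrome (D ∩ ∁ B)) ∩ I
      ≡⟨ ∩-distribʳ-⊕ I (syndrome (D ∩ B)) (syndrome (D ∩ ∁ B)) ⟩
    (syndrome (D ∩ B) ∩ I) ⊕ (syndrome (D ∩ ∁ B) ∩ I)
      ≡⟨ cong ((syndrome (D ∩ B) ∩ I) ⊕_) (Empty-unique outside-invisible) ⟩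
    (syndrome (D ∩ B) ∩ I) ⊕ ⊥                                 ≡⟨ ⊕-identityʳ _ ⟩
    syndrome (D ∩ B) ∩ I                                       ∎
    where
    open ≡-Reasoning
    I = interior B
    split : ∀ {n} (p q : Subset n) → (p ∩ q) ⊕ (p ∩ ∁ q) ≡ p
    split p q = trans (sym (∪≡⊕ (p ∩ q) (p ∩ ∁ q) disjoint))
                      (trans (sym (∩-distribˡ-∪ p q (∁ q))) (trans (cong (p ∩_) (p∪∁p≡⊤ q)) (∩-identityʳ p)))
      where
      disjoint : Empty ((p ∩ q) ∩ (p ∩ ∁ q))
      disjoint (x , x∈) = let x∈pq , x∈p∁q = x∈p∩q⁻ (p ∩ q) (p ∩ ∁ q) x∈ in
        x∈∁p⇒x∉p (p∩q⊆q p (∁ q) x∈p∁q) (p∩q⊆q p q x∈pq)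
    outside-invisible : Empty (syndrome (D ∩ ∁ B) ∩ I)
    outside-invisible (v , v∈) with x∈p∩q⁻ (syndrome (D ∩ ∁ B)) I v∈
    ... | v∈S , v∈I with ∈-oddlyCovered⁻ corners (D ∩ ∁ B) v∈S
    ...   | f , f∈ , v∈f = x∈∁p⇒x∉p (p∩q⊆q D (∁ B) f∈) (faces-at-interior B-block v∈I v∈f)

-- Boundary graphs and existence of the boundary correction.

module DecoderLemmas (L : ColorCodeLattice) {τ : ℕ} .{{_ : NonZero τ}} {C₀ : ℚᵘ}
                     (W : WallSystem L τ C₀) where
  open ColorCodeLattice L
  open WallSystem W
  open Decoder L W
  open Lattice L
  open BlockLemmas L F∂

  private
    edge? : ∀ c (e : Fin #V × Fin #V) → Dec _
    edge? c (u , v) = (u <ᶠ? v) ×-dec HAdjacent? c u v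

    pairs = cartesianProduct (allFin #V) (allFin #V)

    A-spec : ∀ c e → _
    A-spec c e = proj₂ (∈-filter⁻ (edge? c) {xs = pairs} (∈-lookup {xs = A c} e))

  module H c = Graph (src c) (tgt c) H[ c ]
    -- Listed pairs are strictly increasing, hence there are no loops.
    (λ e eq → <-irrefl eq (proj₁ (A-spec c e)))
    (λ e → proj₁ (proj₂ (A-spec c e)))
    (λ e → proj₁ (proj₂ (proj₂ (A-spec c e))))

  HAdjacent-sym : ∀ c → Symmetric (HAdjacent c)
  HAdjacent-sym c {u} {v} (u∈H , v∈H , f , g , f∈F∂ , g∈F∂ , adj , eq) =
    v∈H , u∈H , f , g , f∈F∂ , g∈F∂ , adj , trans eq (∪-comm ⁅ u ⁆ ⁅ v ⁆)

  -- Transfers connectedness from adjacency of vertices to positions in `A c`. A step is found there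
  -- as its increasing pair and reversed if necessary; a step from a vertex to itself becomes the
  -- empty path.
  H-connected : ∀ c → Connected H[ c ] (H.Joined c ⊤)
  H-connected c a∈H b∈H = kleisliStar id step (connected c a∈H b∈H)
    where
    edge : ∀ {u v} → (u , v) ∈ˡ A c → H.Joined c ⊤ u v
    edge uv∈A = index uv∈A , ∈⊤ , inj₁ (cong proj₁ (sym (lookup-index uv∈A)) ,
                                       cong proj₂ (sym (lookup-index uv∈A)))
    ∈-pairs : ∀ u v → (u , v) ∈ˡ pairs
    ∈-pairs u v = ∈-cartesianProduct⁺ (∈-allFin u) (∈-allFin v)
    step : ∀ {u v} → u ∈ H[ c ] × v ∈ H[ c ] × HAdjacent c u v → Path H[ c ] (H.Joined c ⊤) u v
    step {u} {v} (u∈H , v∈H , u~v) with <-cmp u v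
    ... | tri< u<v _ _ = (u∈H , v∈H , edge (∈-filter⁺ (edge? c) (∈-pairs u v) (u<v , u~v))) ◅ ε
    ... | tri≈ _ refl _ = ε
    ... | tri> _ _ v<u with edge (∈-filter⁺ (edge? c) (∈-pairs v u) (v<u , HAdjacent-sym c u~v))
    ...   | e , e∈⊤ , e-joins = (u∈H , v∈H , e , e∈⊤ , swap e-joins) ◅ ε

  spanningTree : ∀ c → ∃ (IsSpanningTree c)
  spanningTree c = H.spanningTree c (H-connected c)

  join : ∀ c {T X} → IsSpanningTree c T → X ⊆ H[ c ] → parity ∣ X ∣ ≡ false → ∃ (IsJoin c T X)
  join c (T-connected , _) X⊆H X-even with H.join c T-connected X⊆H X-even
  ... | J , J⊆T , ∂J = J , J⊆T , trans (oddlyCovered≡⨁ _ J) ∂J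

  -- The set to be matched is given as a syndrome, so that `parity-syndrome` puts all three colors
  -- in the same case, decided by the parity of `∣ D ∣`.
  boundaryCorrection : ∀ D → syndrome D ⊆ V∂ → ∃ (BoundaryCorrection (syndrome D))
  boundaryCorrection D R⊆V∂ = byParity _ (parity-syndrome D)
    where
    R : Color → Subset #V
    R c = syndrome D ∩ V[ c ]
    R⊆H : ∀ c → R c ⊆ H[ c ]
    R⊆H c v∈ = let v∈R , v∈V = x∈p∩q⁻ (syndrome D) V[ c ] v∈ in x∈p∩q⁺ (R⊆V∂ v∈R , v∈V)
    T : ∀ c → Subset (#A c)
    T c = proj₁ (spanningTree c)
    T-tree : ∀ c → IsSpanningTree c (T c)
    T-tree c = proj₂ (spanningTree c)
    byParity : ∀ b → (∀ c → parity ∣ R c ∣ ≡ b) → ∃ (BoundaryCorrection (syndrome D))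
    byParity false R-even =
      _ , even (λ c → parity≡false⇒Even ∣ R c ∣ (R-even c)) T
               (λ c → proj₁ (J c)) T-tree (λ c → proj₂ (J c))
      where
      J : ∀ c → ∃ (IsJoin c (T c) (R c))
      J c = join c (T-tree c) (R⊆H c) (R-even c)
    byParity true R-odd =
      _ , odd (λ c → parity≡true⇒Odd ∣ R c ∣ (R-odd c)) T (λ c → proj₁ (J c)) (λ c → proj₁ (J★ c)) T-tree
              x x∈R (λ c → proj₂ (J c)) (λ c → proj₂ (J★ c))
      where
      R-nonempty : ∀ c → Nonempty (R c)
      R-nonempty c with nonempty? (R c)
      ... | yes nonempty = nonempty
      ... | no  empty    = contradiction
        (trans (sym (R-odd c)) (cong parity (trans (cong ∣_∣ (Empty-unique empty)) (∣⊥∣≡0 #V)))) λ ()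
      x : Color → Fin #V
      x c = proj₁ (R-nonempty c)
      x∈R : ∀ c → x c ∈ R c
      x∈R c = proj₂ (R-nonempty c)
      J : ∀ c → ∃ (IsJoin c (T c) (R c - x c))
      J c = join c (T-tree c) (R⊆H c ∘ p─q⊆p (R c) ⁅ x c ⁆)
        (trans (cong (parity ∘ ∣_∣) (p-x≡p⊕⁅x⁆ (R c) (x∈R c)))
               (trans (parity-⊕ (R c) ⁅ x c ⁆) (cong₂ _xor_ (R-odd c) (parity-⁅⁆ (x c)))))
      pair⊆H : ∀ c → ⁅ x c ⁆ ⊕ ⁅ corner f★ c ⁆ ⊆ H[ c ]
      pair⊆H c v∈ with ∈-⊕⁻ ⁅ x c ⁆ ⁅ corner f★ c ⁆ v∈
      ... | inj₁ v∈x  = subst (_∈ H[ c ]) (sym (x∈⁅y⁆⇒x≡y _ v∈x)) (R⊆H c (x∈R c))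
      ... | inj₂ v∈f★ = subst (_∈ H[ c ]) (sym (x∈⁅y⁆⇒x≡y _ v∈f★)) (f★-corner c)
      J★ : ∀ c → ∃ (IsJoin c (T c) (⁅ x c ⁆ ⊕ ⁅ corner f★ c ⁆))
      -- The pair is even also when `x c` is the corner of `f★`, where it is empty.
      J★ c = join c (T-tree c) (pair⊆H c)
        (trans (parity-⊕ ⁅ x c ⁆ ⁅ corner f★ c ⁆) (cong₂ _xor_ (parity-⁅⁆ (x c)) (parity-⁅⁆ (corner f★ c))))

  -- Syndrome of the boundary correction.

  along : (∀ c → Subset (#A c)) → Color → Subset #F
  along J c = ⨁ (J c) λ e → ⁅ proj₁ (move c e) ⁆ ∪ ⁅ proj₂ (move c e) ⁆

  -- By `isMove` the syndrome of a move is the pair of ends of its edge; linearity does the rest.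
  syndrome-along : ∀ J c → syndrome (along J c) ≡ oddDegree c (J c)
  syndrome-along J c = begin
    syndrome (along J c)            ≡⟨ oddlyCovered-⨁ corners (J c) pair ⟩
    ⨁ (J c) (λ e → syndrome (pair e))
      ≡⟨ ⨁-cong (J c) (λ {e} _ → let _ , _ , _ , eq = isMove c e in eq) ⟩
    ⨁ (J c) (H.endpoints c)         ≡⟨ oddlyCovered≡⨁ (H.endpoints c) (J c) ⟨
    oddDegree c (J c)               ∎
    where
    open ≡-Reasoning
    pair : Fin (#A c) → Subset #F
    pair e = ⁅ proj₁ (move c e) ⁆ ∪ ⁅ proj₂ (move c e) ⁆

  syndrome-moves : ∀ J → syndrome (moves J) ≡ overColors λ c → oddDegree c (J c)
  syndrome-moves J = begin
    syndrome (moves J)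
      ≡⟨ oddlyCovered-⊕ corners (along J red ⊕ along J green) (along J blue) ⟩
    syndrome (along J red ⊕ along J green) ⊕ syndrome (along J blue)
      ≡⟨ cong (_⊕ syndrome (along J blue)) (oddlyCovered-⊕ corners (along J red) (along J green)) ⟩
    overColors (λ c → syndrome (along J c))      ≡⟨ overColors-cong (syndrome-along J) ⟩
    overColors (λ c → oddDegree c (J c))         ∎
    where open ≡-Reasoning

  syndrome-joins : ∀ (T : ∀ c → Subset (#A c)) (X : Color → Subset #V) J →
                   (∀ c → IsJoin c (T c) (X c) (J c)) → syndrome (moves J) ≡ overColors X
  syndrome-joins T X J joins = trans (syndrome-moves J) (overColors-cong (proj₂ ∘ joins))

  -- In the odd case color `c` contributes `(R ∩ V[ c ]) ⊕ ⁅ x c ⁆` from `J`,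
  -- `⁅ x c ⁆ ⊕ ⁅ corner f★ c ⁆` from `J★`, and `⁅ corner f★ c ⁆` from the face `f★`. Both auxiliary
  -- vertices cancel.
  syndrome-boundaryCorrection : ∀ {R E∂} → BoundaryCorrection R E∂ → syndrome E∂ ≡ R
  syndrome-boundaryCorrection {R} (even _ T J _ joins) =
    trans (syndrome-joins T (λ c → R ∩ V[ c ]) J joins) (byColor R)
  syndrome-boundaryCorrection {R} (odd _ T J J★ _ x x∈ joins joins★) = begin
    syndrome (moves J ⊕ moves J★ ⊕ ⁅ f★ ⁆)
      ≡⟨ trans (oddlyCovered-⊕ corners (moves J ⊕ moves J★) ⁅ f★ ⁆)
               (cong₂ _⊕_ (oddlyCovered-⊕ corners (moves J) (moves J★)) (oddlyCovered-⁅⁆ corners f★)) ⟩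
    syndrome (moves J) ⊕ syndrome (moves J★) ⊕ corners f★
      ≡⟨ cong₂ _⊕_ (cong₂ _⊕_ (trans (syndrome-joins T (λ c → (R ∩ V[ c ]) - x c) J joins)
                                     (overColors-cong λ c → p-x≡p⊕⁅x⁆ (R ∩ V[ c ]) (x∈ c)))
                              (syndrome-joins T (λ c → ⁅ x c ⁆ ⊕ ⁅ corner f★ c ⁆) J★ joins★))
                   (trans (sym (byColor (corners f★))) (overColors-cong (corners∩V f★))) ⟩
    overColors p ⊕ overColors q ⊕ overColors r
      ≡⟨ cong (_⊕ overColors r) (overColors-⊕ p q) ⟨
    overColors (λ c → p c ⊕ q c) ⊕ overColors r
      ≡⟨ overColors-⊕ (λ c → p c ⊕ q c) r ⟨
    overColors (λ c → p c ⊕ q c ⊕ r c)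
      ≡⟨ overColors-cong (λ c → telescope (R ∩ V[ c ]) ⁅ x c ⁆ ⁅ corner f★ c ⁆) ⟩
    overColors (λ c → R ∩ V[ c ])
      ≡⟨ byColor R ⟩
    R ∎
    where
    open ≡-Reasoning
    p q r : Color → Subset #V
    p c = (R ∩ V[ c ]) ⊕ ⁅ x c ⁆
    q c = ⁅ x c ⁆ ⊕ ⁅ corner f★ c ⁆
    r c = ⁅ corner f★ c ⁆
    telescope : ∀ {n} (p q r : Subset n) → p ⊕ q ⊕ (q ⊕ r) ⊕ r ≡ p
    telescope p q r = begin
      p ⊕ q ⊕ (q ⊕ r) ⊕ r
        ≡⟨ cong (_⊕ r) (trans (⊕-assoc p q (q ⊕ r)) (cong (p ⊕_) (⊕-cancelˡ q r))) ⟩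
      p ⊕ r ⊕ r              ≡⟨ trans (⊕-assoc p r r) (cong (p ⊕_) (⊕-same r)) ⟩
      p ⊕ ⊥                  ≡⟨ ⊕-identityʳ p ⟩
      p                      ∎

  -- Size of the boundary correction.

  #H : ℕ
  #H = #A red ℕ.+ #A green ℕ.+ #A blue

  -- Every edge of the boundary graphs is charged the two faces of its move, whether or not `J`
  -- selects it.
  ∣moves∣≤ : ∀ J → ∣ moves J ∣ ℕ.≤ #H ℕ.* 2
  ∣moves∣≤ J = begin
    ∣ moves J ∣
      ≤⟨ ℕ.≤-trans (∣p⊕q∣≤∣p∣+∣q∣ (along J red ⊕ along J green) (along J blue))
                  (ℕ.+-monoˡ-≤ _ (∣p⊕q∣≤∣p∣+∣q∣ (along J red) (along J green))) ⟩
    ∣ along J red ∣ ℕ.+ ∣ along J green ∣ ℕ.+ ∣ along J blue ∣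
                   ≤⟨ ℕ.+-mono-≤ (ℕ.+-mono-≤ (∣along∣≤ red) (∣along∣≤ green)) (∣along∣≤ blue) ⟩
    #A red ℕ.* 2 ℕ.+ #A green ℕ.* 2 ℕ.+ #A blue ℕ.* 2
                   ≡⟨ trans (ℕ.*-distribʳ-+ 2 (#A red ℕ.+ #A green) (#A blue))
               (cong (ℕ._+ #A blue ℕ.* 2) (ℕ.*-distribʳ-+ 2 (#A red) (#A green))) ⟨
    #H ℕ.* 2       ∎
    where
    open ℕ.≤-Reasoning
    ∣along∣≤ : ∀ c → ∣ along J c ∣ ℕ.≤ #A c ℕ.* 2
    ∣along∣≤ c = ∣⨁∣≤ (J c) _ λ e → ℕ.≤-trans (∣p∪q∣≤∣p∣+∣q∣ ⁅ proj₁ (move c e) ⁆ ⁅ proj₂ (move c e) ⁆)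
      (ℕ.≤-reflexive (cong₂ ℕ._+_ (∣⁅x⁆∣≡1 (proj₁ (move c e))) (∣⁅x⁆∣≡1 (proj₂ (move c e)))))

  -- In the odd case an edge may be used by `J` and again by `J★`, and `f★` adds one face. The even
  -- case fits in the same bound.
  ∣boundaryCorrection∣≤ : ∀ {R E∂} → BoundaryCorrection R E∂ → ∣ E∂ ∣ ℕ.≤ #H ℕ.* 2 ℕ.+ #H ℕ.* 2 ℕ.+ 1
  ∣boundaryCorrection∣≤ (even _ _ J _ _) =
    ℕ.≤-trans (∣moves∣≤ J) (ℕ.≤-trans (ℕ.m≤m+n _ (#H ℕ.* 2)) (ℕ.m≤m+n _ 1))
  ∣boundaryCorrection∣≤ (odd _ _ J J★ _ _ _ _ _) =
    ℕ.≤-trans (∣p⊕q∣≤∣p∣+∣q∣ (moves J ⊕ moves J★) ⁅ f★ ⁆)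
      (ℕ.+-mono-≤ (ℕ.≤-trans (∣p⊕q∣≤∣p∣+∣q∣ (moves J) (moves J★)) (ℕ.+-mono-≤ (∣moves∣≤ J) (∣moves∣≤ J★)))
                  (ℕ.≤-reflexive (∣⁅x⁆∣≡1 f★)))

  -- Local corrections and the residual syndrome.

  restriction : ∀ {S B} E → syndrome E ≡ S → IsBlock B → IsLocalCorrection S B (E ∩ B)
  restriction {S} {B} E refl B-block = p∩q⊆q E B , sym (syndrome-interior E B-block)

  localCorrection : ∀ {S} → Valid S → ∀ {B} → IsBlock B → ∃ (IsMinimum (IsLocalCorrection S B))
  localCorrection {S} (E , ∂E) {B} B-block =
    minimum (λ E′ → (E′ ⊆? B) ×-dec ((syndrome E′ ∩ interior B) ≟ˢ (S ∩ interior B)))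
            (E ∩ B , restriction E ∂E B-block)

  module _ (bs : Blocks) where
    open Blocks bs

    block-disjoint : ∀ {i j f} → f ∈ block i → f ∈ block j → i ≡ j
    block-disjoint {i} {j} f∈i f∈j = distinct (component-unique Adjacent-sym (isBlock i) (isBlock j) f∈i f∈j)

    module _ (E : Fin q → Subset #F) (E⊆ : ∀ i → E i ⊆ block i) where

      -- The blocks are disjoint, so every other local correction vanishes on block `i`.
      ⨁∩block : ∀ i → ⨁ ⊤ E ∩ block i ≡ E i
      ⨁∩block i = begin
        ⨁ ⊤ E ∩ block i
          ≡⟨ ⨁-map (_∩ block i) (∩-zeroˡ (block i)) (∩-distribʳ-⊕ (block i)) ⊤ E ⟩
        ⨁ ⊤ (λ j → E j ∩ block i)     ≡⟨ ⨁-single i (λ j → E j ∩ block i) elsewhere ⟩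
        E i ∩ block i                 ≡⟨ p⊆q⇒p∩q≡p (E⊆ i) ⟩
        E i                           ∎
        where
        open ≡-Reasoning
        elsewhere : ∀ {j} → j ≢ i → E j ∩ block i ≡ ⊥
        elsewhere {j} j≢i = Empty-unique λ (f , f∈) → let f∈Ej , f∈Bi = x∈p∩q⁻ (E j) (block i) f∈ in
          j≢i (block-disjoint (E⊆ j f∈Ej) f∈Bi)

    -- Written as the syndrome of `E₀ ⊕ ⨁ ⊤ E`, the residual provides a face at `v`. If `v` is off
    -- the walls, it is interior to the block of that face, where by locality the syndromes of `E₀`
    -- and of the local corrections agree and cancel.
    residual⊆V∂ : ∀ {S} → Valid S → (E : Fin q → Subset #F) → (∀ i → IsLocalCorrection S (block i) (E i)) →
                  S ⊕ syndrome (⨁ ⊤ E) ⊆ V∂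
    residual⊆V∂ {S} (E₀ , refl) E E-local {v} v∈R with v ∈? V∂
    ... | yes v∈V∂ = v∈V∂
    ... | no  v∉V∂ with ∈-oddlyCovered⁻ corners (E₀ ⊕ ⨁ ⊤ E)
                          (subst (v ∈_) (sym (oddlyCovered-⊕ corners E₀ (⨁ ⊤ E))) v∈R)
    ...   | f , _ , v∈f with componentOf Fint Adjacent? (∉V∂⇒∈Fint v∉V∂ v∈f)
    ...     | B , B-block , f∈B with exhaustive B-block
    ...       | i , refl = contradiction (subst (v ∈_) vanishes (x∈p∩q⁺ (v∈R , v∈I))) ∉⊥
      where
      open ≡-Reasoning
      I = interior (block i)
      v∈I : v ∈ I
      v∈I = x∈p∩q⁺ (∈-vertices⁺ f∈B v∈f , x∉p⇒x∈∁p v∉V∂)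
      vanishes : (syndrome E₀ ⊕ syndrome (⨁ ⊤ E)) ∩ I ≡ ⊥
      vanishes = begin
        (syndrome E₀ ⊕ syndrome (⨁ ⊤ E)) ∩ I
          ≡⟨ ∩-distribʳ-⊕ I (syndrome E₀) (syndrome (⨁ ⊤ E)) ⟩
        (syndrome E₀ ∩ I) ⊕ (syndrome (⨁ ⊤ E) ∩ I)
          ≡⟨ cong ((syndrome E₀ ∩ I) ⊕_) (syndrome-interior (⨁ ⊤ E) (isBlock i)) ⟩
        (syndrome E₀ ∩ I) ⊕ (syndrome (⨁ ⊤ E ∩ block i) ∩ I)
          ≡⟨ cong (λ D → (syndrome E₀ ∩ I) ⊕ (syndrome D ∩ I)) (⨁∩block E (proj₁ ∘ E-local) i) ⟩
        (syndrome E₀ ∩ I) ⊕ (syndrome (E i) ∩ I)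
          ≡⟨ cong ((syndrome E₀ ∩ I) ⊕_) (proj₂ (E-local i)) ⟩
        (syndrome E₀ ∩ I) ⊕ (syndrome E₀ ∩ I)               ≡⟨ ⊕-same (syndrome E₀ ∩ I) ⟩
        ⊥                                                   ∎

    ∣local∣≤OPT : ∀ {S} (valid : Valid S) (E : Fin q → Subset #F) →
                  (∀ i → IsMinimum (IsLocalCorrection S (block i)) (E i)) → ∣ ⨁ ⊤ E ∣ ℕ.≤ OPT valid
    -- This is the minimum that defines `OPT`. Its restriction to a block competes with the local
    -- minimum there.
    ∣local∣≤OPT {S} valid E E-min with minimum (λ E → syndrome E ≟ˢ S) valid
    ... | E* , ∂E* , _ = ∣⨁∣≤-partition E* block E block-disjoint
                           (λ i → proj₂ (E-min i) (E* ∩ block i) (restriction E* ∂E* (isBlock i)))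

  -- Existence, correctness and size of the output.

  output : ∀ {S} → Valid S → ∃ (Outputs S)
  output {S} valid@(E₀ , ∂E₀) with nonempty? S
  ... | no  S-empty = ⊥ , trivial (Empty-unique S-empty)
  ... | yes S-nonempty = _ , decode S-nonempty blocks E E-min
    (subst (λ R → BoundaryCorrection R (proj₁ correction)) R≡ (proj₂ correction))
    where
    open Blocks blocks
    E     = λ i → proj₁ (localCorrection valid (isBlock i))
    E-min = λ i → proj₂ (localCorrection valid (isBlock i))
    -- Validity of `S` makes the residual a syndrome, the form that `boundaryCorrection` takes.
    R≡ : syndrome (E₀ ⊕ ⨁ ⊤ E) ≡ S ⊕ syndrome (⨁ ⊤ E)
    R≡ = trans (oddlyCovered-⊕ corners E₀ (⨁ ⊤ E)) (cong (_⊕ syndrome (⨁ ⊤ E)) ∂E₀)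
    correction = boundaryCorrection (E₀ ⊕ ⨁ ⊤ E)
      (λ {v} v∈ → residual⊆V∂ blocks valid E (proj₁ ∘ E-min) (subst (v ∈_) R≡ v∈))

  syndrome-output : ∀ {S E} → Outputs S E → syndrome E ≡ S
  syndrome-output (trivial refl) = oddlyCovered-⊥ corners
  syndrome-output {S} (decode _ bs E _ {E∂} correction) = begin
    syndrome (Eloc ⊕ E∂)                      ≡⟨ oddlyCovered-⊕ corners Eloc E∂ ⟩
    syndrome Eloc ⊕ syndrome E∂
      ≡⟨ cong (syndrome Eloc ⊕_) (syndrome-boundaryCorrection correction) ⟩
    syndrome Eloc ⊕ (S ⊕ syndrome Eloc)       ≡⟨ ⊕-cancelʳ (syndrome Eloc) S ⟩
    S                                         ∎
    where
    open ≡-Reasoning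
    Eloc = ⨁ ⊤ E

  ∣output∣≤ : ∀ {S E} (valid : Valid S) → Outputs S E → ∣ E ∣ ℕ.≤ OPT valid ℕ.+ (#H ℕ.* 2 ℕ.+ #H ℕ.* 2 ℕ.+ 1)
  ∣output∣≤ valid (trivial _) = ℕ.≤-trans (ℕ.≤-reflexive (∣⊥∣≡0 #F)) ℕ.z≤n
  ∣output∣≤ valid (decode _ bs E E-min {E∂} correction) =
    ℕ.≤-trans (∣p⊕q∣≤∣p∣+∣q∣ (⨁ ⊤ E) E∂)
      (ℕ.+-mono-≤ (∣local∣≤OPT bs valid E E-min) (∣boundaryCorrection∣≤ correction))

-- Passage to the rationals and the final constant.

fromℕ-+ : ∀ i j → fromℕ (i ℕ.+ j) ≡ fromℕ i + fromℕ j
-- All denominators are 1, so equality holds without normalisation.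
fromℕ-+ i j = cong (λ z → mkℚᵘ z 0) (sym (cong₂ ℤ._+_ (ℤ.*-identityʳ (ℤ.+ i)) (ℤ.*-identityʳ (ℤ.+ j))))

fromℕ-* : ∀ i j → fromℕ (i ℕ.* j) ≡ fromℕ i * fromℕ j
fromℕ-* i j = cong (λ z → mkℚᵘ z 0) (ℤ.pos-* i j)

fromℕ-mono-≤ : ∀ {i j} → i ℕ.≤ j → fromℕ i ≤ fromℕ j
fromℕ-mono-≤ i≤j = ℚ.*≤* (ℤ.*-monoʳ-≤-nonNeg (ℤ.+ 1) (ℤ.+≤+ i≤j))

-- Used with `τ≤n` to absorb the single face `f★` into the error term.
1≤ratio : ∀ {i d} .{{_ : NonZero d}} → d ℕ.≤ i → fromℕ 1 ≤ ratio i d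
1≤ratio {i} {d@(ℕ.suc _)} d≤i =
  ℚ.*≤* (subst₂ ℤ._≤_ (sym (ℤ.*-identityˡ (ℤ.+ d))) (sym (ℤ.*-identityʳ (ℤ.+ i))) (ℤ.+≤+ d≤i))

lemma4 : ∀ (C₀ : ℚᵘ) → Positive C₀ →
    ∃ λ (C : ℚᵘ) → Positive C ×
      (∀ (L : ColorCodeLattice) (τ : ℕ) .{{_ : NonZero τ}} (W : WallSystem L τ C₀) →
        let open ColorCodeLattice L
            open Decoder L W
        in
        (S : Subset #V) (valid : Valid S) →
        (∃ λ E → Outputs S E) ×
        (∀ E → Outputs S E →
          syndrome E ≡ S ×
          fromℕ ∣ E ∣ ≤ fromℕ (OPT valid) + C * ratio #V τ))
lemma4 C₀ C₀>0 = C , C>0 , λ L τ W S valid → let open DecoderLemmas L W in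
  output valid , λ E out → syndrome-output out , bound L W valid E out
  where
  C : ℚᵘ
  -- Four faces for each boundary edge, at most `C₀` times n/τ edges, and one further n/τ for `f★`.
  C = fromℕ 4 * C₀ + fromℕ 1

  C>0 : Positive C
  C>0 = ℚ.pos+pos⇒pos (fromℕ 4 * C₀) {{ℚ.pos*pos⇒pos (fromℕ 4) C₀ {{C₀>0}}}} (fromℕ 1)

  bound : ∀ (L : ColorCodeLattice) {τ : ℕ} .{{_ : NonZero τ}} (W : WallSystem L τ C₀) →
          let open ColorCodeLattice L
              open Decoder L W
          in
          ∀ {S} (valid : Valid S) E → Outputs S E →
          fromℕ ∣ E ∣ ≤ fromℕ (OPT valid) + C * ratio #V τ
  bound L {τ} W valid E out = begin
    fromℕ ∣ E ∣                                         ≤⟨ fromℕ-mono-≤ (∣output∣≤ valid out) ⟩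
    fromℕ (OPT valid ℕ.+ (#H ℕ.* 2 ℕ.+ #H ℕ.* 2 ℕ.+ 1))
      ≡⟨ cong (λ i → fromℕ (OPT valid ℕ.+ (i ℕ.+ 1))) four ⟩
    fromℕ (OPT valid ℕ.+ (4 ℕ.* #H ℕ.+ 1))              ≡⟨ fromℕ-+ (OPT valid) _ ⟩
    fromℕ (OPT valid) + fromℕ (4 ℕ.* #H ℕ.+ 1)
      ≡⟨ cong (fromℕ (OPT valid) +_) (trans (fromℕ-+ (4 ℕ.* #H) 1)
                                          (cong (_+ fromℕ 1) (fromℕ-* 4 #H))) ⟩
    fromℕ (OPT valid) + (fromℕ 4 * fromℕ #H + fromℕ 1)
      ≤⟨ ℚ.+-monoʳ-≤ (fromℕ (OPT valid))
           (ℚ.+-mono-≤ (ℚ.*-monoʳ-≤-nonNeg (fromℕ 4) few-edges) (1≤ratio τ≤n)) ⟩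
    fromℕ (OPT valid) + (fromℕ 4 * (C₀ * r) + r)        ≃⟨ ℚ.+-congʳ (fromℕ (OPT valid)) collect ⟩
    fromℕ (OPT valid) + C * r                           ∎
    where
    open ColorCodeLattice L
    open WallSystem W
    open DecoderLemmas L W
    open ℚ.≤-Reasoning
    r = ratio #V τ
    four : #H ℕ.* 2 ℕ.+ #H ℕ.* 2 ≡ 4 ℕ.* #H
    four = trans (sym (ℕ.*-distribˡ-+ #H 2 2)) (ℕ.*-comm #H 4)
    collect : fromℕ 4 * (C₀ * r) + r ℚ.≃ C * r
    collect = ℚ.≃-sym (ℚ.≃-trans (ℚ.*-distribʳ-+ r (fromℕ 4 * C₀) (fromℕ 1))
                                 (ℚ.+-cong (ℚ.*-assoc (fromℕ 4) C₀ r) (ℚ.*-identityˡ r)))
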